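{- Let $\ell\geqslant 1$ and $h\geqslant 0$ be integers, and let $\Gamma$ be an abelian group of order $16(2\ell+1)(2h+1)$. Then a $\Gamma$-magic rectangle set $\mathrm{MRS}_\Gamma(2\ell+1,8;4h+2)$ exists if and only if $\Gamma$ has more than one involution.
   Context: Let $(\Gamma,+)$ be a finite abelian group of order $abc$. A $\Gamma$-magic rectangle set $\mathrm{MRS}_\Gamma(a,b;c)$ is a collection of $c$ arrays of size $a\times b$ whose entries are elements of $\Gamma$, such that every element of $\Gamma$ appears exactly once and in exactly one of the arrays, and there are elements $\omega,\delta\in\Gamma$ such that, in every array, the sum of the entries of each row equals $\omega$ and the sum of the entries of each column equals $\delta$. An involution is an element of order $2$. -}

module Defs where

open import Level using (Level; _⊔_)
open import Data.Nat using (ℕ; zero; suc)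
open import Data.Fin using (Fin; zero; suc)
open import Data.Product using (Σ; ∃; _×_; _,_)
open import Relation.Binary.PropositionalEquality using (_≡_)
open import Relation.Nullary using (¬_)
open import Algebra.Bundles using (AbelianGroup)
open import Function.Bundles using (Bijection)
open import Relation.Binary.PropositionalEquality.Properties using () renaming (setoid to ≡-setoid)

module _ {c ℓ : Level} (Γ : AbelianGroup c ℓ) where
  open AbelianGroup Γ

  HasOrder : ℕ → Set (c ⊔ ℓ)
  HasOrder N = Bijection (≡-setoid (Fin N)) setoid

  sumΓ : (n : ℕ) → (Fin n → Carrier) → Carrier
  sumΓ zero    f = ε
  sumΓ (suc n) f = f zero ∙ sumΓ n (λ i → f (suc i))

  IsInvolution : Carrier → Set ℓ
  IsInvolution x = (¬ (x ≈ ε)) × (x ∙ x ≈ ε)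

  MoreThanOneInvolution : Set (c ⊔ ℓ)
  MoreThanOneInvolution =
    Σ Carrier λ x → Σ Carrier λ y → IsInvolution x × IsInvolution y × ¬ (x ≈ y)

  record MRS (a b c' : ℕ) : Set (c ⊔ ℓ) where
    field
      A : Fin c' → Fin a → Fin b → Carrier
      injective : ∀ k i j k' i' j' → A k i j ≈ A k' i' j' →
                  (k ≡ k') × (i ≡ i') × (j ≡ j')
      surjective : ∀ g → Σ (Fin c') λ k → Σ (Fin a) λ i → Σ (Fin b) λ j → A k i j ≈ g
      ω δ : Carrier
      rowSum : ∀ k i → sumΓ b (λ j → A k i j) ≈ ω
      colSum : ∀ k j → sumΓ a (λ i → A k i j) ≈ δ

{-# OPTIONS --safe #-}
-- Write m = 2l + 1 and n = 2h + 1, so that |Γ| = 16mn.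
--
-- Necessity: in a magic rectangle set the sum S of all elements is 16nδ, hence mS = 0. If ι were the
-- only involution, pairing g with −g would give S = ι, of order 2, contradicting that m is odd.
--
-- Sufficiency: choose subgroups P ⊆ H ⊆ Γ with |P| = 16 and |H| = 16n, and systems of representatives
-- {0, ±yᵢ} of H/P and {0, ±xᵢ} of Γ/H (both quotients have odd order). All line sums will be 0.
-- A column of height m consists of a triple (α, x₀ + β, −x₀ + γ) with α, β, γ ∈ H, α + β + γ = 0, in
-- some order, followed by the pairs ±(xᵢ + α) for i ≥ 1; the columns fill Γ as soon as each of α, β, γ
-- runs through H. Over the cosets ±yᵢ + P the triples are ±(p + yᵢ, p′ + yᵢ, p″ − 2yᵢ) with
-- p + p′ + p″ = 0 in P, and a column sits next to its negative, which annihilates the H-part of the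
-- row sums. Over P itself the arrangement is found by computer. As Γ has two involutions, P is
-- generated by x, y, z, w with 2x = 2y = 0, 2z ∈ ⟨x, y⟩, 2w ∈ ⟨x, y, z⟩, which leaves 4 · 8 cases.
module Submission where

open import Defs
open import Level using (Level; _⊔_)
open import Algebra.Bundles using (AbelianGroup)
open import Data.Bool using (true; false; if_then_else_)
open import Data.Fin as Fin
  using (Fin; zero; suc; toℕ; fromℕ<; combine; remQuot; quotRem; splitAt; join; punchOut)
open import Data.Fin.Patterns using (0F; 1F; 2F; 3F; 4F; 5F; 6F; 7F)
open import Data.Fin.Permutation using (permutation)
import Data.Fin.Properties as Fin
open import Data.List using (List; []; _∷_)
open import Data.List.Relation.Unary.All using (All; []; _∷_)
open import Data.Nat as ℕ using (ℕ; zero; suc; _*_; _+_; _∸_; _≤_; _<_; _≥_; _/_; z≤n; s≤s)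
open import Data.Nat.Coprimality using (Coprime; coprime-Bézout; prime⇒coprime)
open import Data.Nat.Divisibility using (_∣_; divides; _∣?_; *-cancelˡ-∣; ∣-trans; m∣m*n; ∣1⇒≡1)
open import Data.Nat.DivMod using (_mod_)
open import Data.Nat.GCD using (module Bézout)
open import Data.Nat.Induction using (<-wellFounded)
open import Data.Nat.ListAction using (product)
open import Data.Nat.Primality
  using (Prime; euclidsLemma; prime⇒irreducible; prime⇒nonTrivial; ¬prime[0]; ¬prime[1]; prime[2])
open import Data.Nat.Primality.Factorisation using (factorise; module PrimeFactorisation)
import Data.Nat.Properties as ℕ
open import Data.Nat.Tactic.RingSolver using (solve-∀)
open import Data.Product using (Σ; ∃; _×_; _,_; proj₁; proj₂; uncurry; swap; map₂)
open import Data.Sum as Sum using (_⊎_; inj₁; inj₂; [_,_]′)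
open import Data.Unit using (tt)
open import Data.Vec as Vec using (Vec; []; _∷_; lookup; zipWith; replicate)
import Data.Vec.Functional as Vector
open import Function using (_∘_; mk⇔)
open import Function.Bundles using (Bijection; _⇔_)
open import Induction.WellFounded using (Acc; acc)
open import Relation.Binary using (Decidable; tri<; tri≈; tri>)
open import Relation.Binary.PropositionalEquality as ≡ using (_≡_; _≢_)
open import Relation.Nullary using (¬_; Dec; yes; no; contradiction; does)
open import Relation.Nullary.Decidable
  using (¬?; map′; decidable-stable; dec-true; dec-false; toWitness; _×-dec_)

-- A section of `f` is injective. If it failed to send `f k` back to `k`, it would miss `k`
-- altogether, and punching out `k` would leave an injection of `Fin (suc m)` into `Fin m`.
surjective⇒injective : ∀ {m n} → m ≡ n → (f : Fin m → Fin n) → (∀ y → ∃ λ x → f x ≡ y) →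
                       ∀ {i j} → f i ≡ f j → i ≡ j
surjective⇒injective {suc m} ≡.refl f surjective {i} {j} fi≡fj =
  ≡.trans (≡.sym (section-f i)) (≡.trans (≡.cong section fi≡fj) (section-f j))
  where
  section : Fin (suc m) → Fin (suc m)
  section = proj₁ ∘ surjective
  f-section : ∀ y → f (section y) ≡ y
  f-section = proj₂ ∘ surjective
  section-f : ∀ k → section (f k) ≡ k
  section-f k with section (f k) Fin.≟ k
  ... | yes s≡k = s≡k
  ... | no  s≢k = contradiction (Fin.injective⇒≤ {f = λ y → punchOut (misses y)} λ {x} {y} eq →
          ≡.trans (≡.sym (f-section x)) (≡.trans (≡.cong f (Fin.punchOut-injective (misses x) (misses y) eq))
            (f-section y))) ℕ.1+n≰n
    where
    misses : ∀ y → k ≢ section y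
    misses y k≡s = s≢k (≡.trans (≡.cong section (≡.trans (≡.cong f k≡s) (f-section y))) (≡.sym k≡s))

-- Linear identities in an abelian group, decided by comparing coefficients

module AbelianGroupSolver {c ℓ : Level} (Γ : AbelianGroup c ℓ) where
  open AbelianGroup Γ
  open import Algebra.Properties.CommutativeMonoid.Mult commutativeMonoid
    renaming (_×_ to _·_)
  open import Algebra.Properties.CommutativeSemigroup commutativeSemigroup using (interchange)
  open import Algebra.Properties.Group group using (∙-cancelʳ)
  open import Relation.Binary.Reasoning.Setoid setoid

  infixr 6 _⊕_
  infix 8 ⊝_
  infixr 7 _⊛_
  data Expr (n : ℕ) : Set where
    var : Fin n → Expr n
    𝟘   : Expr n
    _⊕_ : Expr n → Expr n → Expr n
    ⊝_  : Expr n → Expr n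
    _⊛_ : ℕ → Expr n → Expr n

  private variable n : ℕ

  ⟦_⟧ : Expr n → Vec Carrier n → Carrier
  ⟦ var i ⟧ ρ = lookup ρ i
  ⟦ 𝟘 ⟧ ρ = ε
  ⟦ a ⊕ b ⟧ ρ = ⟦ a ⟧ ρ ∙ ⟦ b ⟧ ρ
  ⟦ ⊝ a ⟧ ρ = ⟦ a ⟧ ρ ⁻¹
  ⟦ k ⊛ a ⟧ ρ = k · ⟦ a ⟧ ρ

  private
    _+ᵛ_ : Vec ℕ n → Vec ℕ n → Vec ℕ n
    _+ᵛ_ = zipWith _+_

    unit : Fin n → Vec ℕ n
    unit zero    = 1 ∷ replicate _ 0
    unit (suc i) = 0 ∷ unit i

    pos neg : Expr n → Vec ℕ n
    pos (var i) = unit i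
    pos 𝟘       = replicate _ 0
    pos (a ⊕ b) = pos a +ᵛ pos b
    pos (⊝ a)   = neg a
    pos (k ⊛ a) = Vec.map (k *_) (pos a)
    neg (var i) = replicate _ 0
    neg 𝟘       = replicate _ 0
    neg (a ⊕ b) = neg a +ᵛ neg b
    neg (⊝ a)   = pos a
    neg (k ⊛ a) = Vec.map (k *_) (neg a)

    monomial : Vec ℕ n → Vec Carrier n → Carrier
    monomial []       []      = ε
    monomial (k ∷ ks) (x ∷ ρ) = k · x ∙ monomial ks ρ

    monomial-0 : (ρ : Vec Carrier n) → monomial (replicate n 0) ρ ≈ ε
    monomial-0 []      = refl
    monomial-0 (x ∷ ρ) = trans (identityˡ _) (monomial-0 ρ)

    monomial-unit : ∀ i (ρ : Vec Carrier n) → monomial (unit i) ρ ≈ lookup ρ i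
    monomial-unit zero    (x ∷ ρ) = trans (∙-cong (identityʳ x) (monomial-0 ρ)) (identityʳ x)
    monomial-unit (suc i) (x ∷ ρ) = trans (identityˡ _) (monomial-unit i ρ)

    monomial-+ : ∀ (u v : Vec ℕ n) ρ → monomial (u +ᵛ v) ρ ≈ monomial u ρ ∙ monomial v ρ
    monomial-+ []      []      []      = sym (identityˡ ε)
    monomial-+ (j ∷ u) (k ∷ v) (x ∷ ρ) =
      trans (∙-cong (×-homo-+ x j k) (monomial-+ u v ρ)) (interchange _ _ _ _)

    monomial-* : ∀ k (u : Vec ℕ n) ρ → monomial (Vec.map (k *_) u) ρ ≈ k · monomial u ρ
    monomial-* k []      []      = sym (k·ε k)
      where
      k·ε : ∀ k → k · ε ≈ ε
      k·ε zero    = refl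
      k·ε (suc k) = trans (identityˡ _) (k·ε k)
    monomial-* k (j ∷ u) (x ∷ ρ) =
      trans (∙-cong (sym (×-assocˡ x k j)) (monomial-* k u ρ)) (sym (×-distrib-+ _ _ k))

    -- Adding the negative part to the value avoids integer coefficients: negation merely exchanges
    -- `pos` and `neg`.
    correct : ∀ (e : Expr n) ρ → ⟦ e ⟧ ρ ∙ monomial (neg e) ρ ≈ monomial (pos e) ρ
    correct (var i) ρ = trans (∙-cong (sym (monomial-unit i ρ)) (monomial-0 ρ)) (identityʳ _)
    correct 𝟘       ρ = identityˡ _
    correct (a ⊕ b) ρ = begin
      ⟦ a ⟧ ρ ∙ ⟦ b ⟧ ρ ∙ monomial (neg a +ᵛ neg b) ρ
        ≈⟨ ∙-congˡ (monomial-+ (neg a) (neg b) ρ) ⟩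
      ⟦ a ⟧ ρ ∙ ⟦ b ⟧ ρ ∙ (monomial (neg a) ρ ∙ monomial (neg b) ρ)
        ≈⟨ interchange _ _ _ _ ⟩
      ⟦ a ⟧ ρ ∙ monomial (neg a) ρ ∙ (⟦ b ⟧ ρ ∙ monomial (neg b) ρ)
        ≈⟨ ∙-cong (correct a ρ) (correct b ρ) ⟩
      monomial (pos a) ρ ∙ monomial (pos b) ρ
        ≈⟨ monomial-+ (pos a) (pos b) ρ ⟨
      monomial (pos a +ᵛ pos b) ρ ∎
    correct (⊝ a) ρ = begin
      ⟦ a ⟧ ρ ⁻¹ ∙ monomial (pos a) ρ                     ≈⟨ ∙-congˡ (correct a ρ) ⟨
      ⟦ a ⟧ ρ ⁻¹ ∙ (⟦ a ⟧ ρ ∙ monomial (neg a) ρ)         ≈⟨ assoc _ _ _ ⟨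
      ⟦ a ⟧ ρ ⁻¹ ∙ ⟦ a ⟧ ρ ∙ monomial (neg a) ρ           ≈⟨ ∙-congʳ (inverseˡ _) ⟩
      ε ∙ monomial (neg a) ρ                              ≈⟨ identityˡ _ ⟩
      monomial (neg a) ρ                                  ∎
    correct (k ⊛ a) ρ = begin
      k · ⟦ a ⟧ ρ ∙ monomial (Vec.map (k *_) (neg a)) ρ   ≈⟨ ∙-congˡ (monomial-* k (neg a) ρ) ⟩
      k · ⟦ a ⟧ ρ ∙ k · monomial (neg a) ρ                ≈⟨ ×-distrib-+ _ _ k ⟨
      k · (⟦ a ⟧ ρ ∙ monomial (neg a) ρ)                  ≈⟨ ×-congʳ k (correct a ρ) ⟩
      k · monomial (pos a) ρ                              ≈⟨ monomial-* k (pos a) ρ ⟨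
      monomial (Vec.map (k *_) (pos a)) ρ                 ∎

  -- Both sides are compared after moving the negative parts across, so only natural
  -- coefficients occur.
  solve : ∀ (ρ : Vec Carrier n) (a b : Expr n) → pos a +ᵛ neg b ≡ pos b +ᵛ neg a → ⟦ a ⟧ ρ ≈ ⟦ b ⟧ ρ
  solve ρ a b eq = ∙-cancelʳ (monomial (neg a) ρ ∙ monomial (neg b) ρ) _ _ (begin
    ⟦ a ⟧ ρ ∙ (monomial (neg a) ρ ∙ monomial (neg b) ρ)  ≈⟨ assoc _ _ _ ⟨
    ⟦ a ⟧ ρ ∙ monomial (neg a) ρ ∙ monomial (neg b) ρ    ≈⟨ ∙-congʳ (correct a ρ) ⟩
    monomial (pos a) ρ ∙ monomial (neg b) ρ              ≈⟨ monomial-+ (pos a) (neg b) ρ ⟨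
    monomial (pos a +ᵛ neg b) ρ                          ≡⟨ ≡.cong (λ v → monomial v ρ) eq ⟩
    monomial (pos b +ᵛ neg a) ρ                          ≈⟨ monomial-+ (pos b) (neg a) ρ ⟩
    monomial (pos b) ρ ∙ monomial (neg a) ρ              ≈⟨ ∙-congʳ (correct b ρ) ⟨
    ⟦ b ⟧ ρ ∙ monomial (neg b) ρ ∙ monomial (neg a) ρ    ≈⟨ assoc _ _ _ ⟩
    ⟦ b ⟧ ρ ∙ (monomial (neg b) ρ ∙ monomial (neg a) ρ)  ≈⟨ ∙-congˡ (comm _ _) ⟩
    ⟦ b ⟧ ρ ∙ (monomial (neg a) ρ ∙ monomial (neg b) ρ)  ∎)

-- Finite sums, and the sum of all elements of a group

module Sums {c ℓ : Level} (Γ : AbelianGroup c ℓ) where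
  open AbelianGroup Γ
  open import Algebra.Properties.CommutativeMonoid.Mult commutativeMonoid
    renaming (_×_ to _·_)
  open import Algebra.Properties.CommutativeMonoid.Sum commutativeMonoid
    using (sum; sum-permute; ∑-distrib-+; sum-cong-≋; sum-replicate-zero)
  open import Algebra.Properties.CommutativeSemigroup commutativeSemigroup using (interchange)
  open import Algebra.Properties.Group group using (⁻¹-involutive; inverseʳ-unique)
  open import Relation.Binary.Reasoning.Setoid setoid

  sumΓ-cong : ∀ n {f g : Fin n → Carrier} → (∀ i → f i ≈ g i) → sumΓ Γ n f ≈ sumΓ Γ n g
  sumΓ-cong zero    eq = refl
  sumΓ-cong (suc n) eq = ∙-cong (eq zero) (sumΓ-cong n (eq ∘ suc))

  sumΓ-const : ∀ n x → sumΓ Γ n (λ _ → x) ≈ n · x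
  sumΓ-const zero    x = refl
  sumΓ-const (suc n) x = ∙-congˡ (sumΓ-const n x)

  sumΓ-ε : ∀ n → sumΓ Γ n (λ _ → ε) ≈ ε
  sumΓ-ε zero    = refl
  sumΓ-ε (suc n) = trans (identityˡ _) (sumΓ-ε n)

  sumΓ-∙ : ∀ n (f g : Fin n → Carrier) → sumΓ Γ n (λ i → f i ∙ g i) ≈ sumΓ Γ n f ∙ sumΓ Γ n g
  sumΓ-∙ zero    f g = sym (identityˡ ε)
  sumΓ-∙ (suc n) f g = trans (∙-congˡ (sumΓ-∙ n (f ∘ suc) (g ∘ suc))) (interchange _ _ _ _)

  sumΓ≈sum : ∀ n f → sumΓ Γ n f ≈ sum f
  sumΓ≈sum zero    f = refl
  sumΓ≈sum (suc n) f = ∙-congˡ (sumΓ≈sum n (f ∘ suc))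

  sumΓ-splitAt : ∀ m n (f : Fin m ⊎ Fin n → Carrier) →
                 sumΓ Γ (m + n) (f ∘ splitAt m) ≈ sumΓ Γ m (f ∘ inj₁) ∙ sumΓ Γ n (f ∘ inj₂)
  sumΓ-splitAt zero    n f = sym (identityˡ _)
  sumΓ-splitAt (suc m) n f = trans (∙-congˡ (trans (sumΓ-cong (m + n) (λ i → pointwise (splitAt m i)))
    (sumΓ-splitAt m n f′))) (sym (assoc _ _ _))
    where
    f′ : Fin m ⊎ Fin n → Carrier
    f′ = [ f ∘ inj₁ ∘ suc , f ∘ inj₂ ]′
    pointwise : ∀ x → f (Sum.map suc (λ j → j) x) ≈ f′ x
    pointwise (inj₁ _) = refl
    pointwise (inj₂ _) = refl

  sumΓ-remQuot : ∀ m n (f : Fin m × Fin n → Carrier) →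
                 sumΓ Γ (m * n) (f ∘ remQuot {m} n) ≈ sumΓ Γ m (λ i → sumΓ Γ n (λ j → f (i , j)))
  sumΓ-remQuot zero    n f = refl
  sumΓ-remQuot (suc m) n f = trans (sumΓ-cong (n + m * n) (λ x → pointwise (splitAt n x)))
    (trans (sumΓ-splitAt n (m * n) f′) (∙-congˡ (sumΓ-remQuot m n (λ (i , j) → f (suc i , j)))))
    where
    f′ : Fin n ⊎ Fin (m * n) → Carrier
    f′ = [ (λ j → f (zero , j)) , (λ x → f (suc (proj₁ (remQuot {m} n x)) , proj₂ (remQuot {m} n x))) ]′
    pointwise : ∀ s → f (swap ([ (_, zero) , map₂ suc ∘ quotRem {m} n ]′ s)) ≈ f′ s
    pointwise (inj₁ _) = refl
    pointwise (inj₂ _) = refl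

  sum-indicator : ∀ {n} (k : Fin n) x → sum (λ i → if does (i Fin.≟ k) then x else ε) ≈ x
  sum-indicator {suc n} zero x = trans (∙-congˡ (sum-replicate-zero n)) (identityʳ x)
  sum-indicator (suc k) x = trans (identityˡ _) (sum-indicator k x)

  module _ {ι : Carrier} (ι-involution : IsInvolution Γ ι)
           (unique : ∀ {x} → IsInvolution Γ x → x ≈ ι) (ε? : ∀ x → Dec (x ≈ ε))
           {n} (f : Fin n → Carrier) (f-injective : ∀ {i j} → f i ≈ f j → i ≡ j)
           (f-surjective : ∀ x → ∃ λ i → f i ≈ x) where
    private
      opposite : Fin n → Fin n
      opposite i = proj₁ (f-surjective (f i ⁻¹))

      f-opposite : ∀ i → f (opposite i) ≈ f i ⁻¹
      f-opposite i = proj₂ (f-surjective (f i ⁻¹))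

      opposite-opposite : ∀ i → opposite (opposite i) ≡ i
      opposite-opposite i = f-injective (trans (f-opposite _) (trans (⁻¹-cong (f-opposite i)) (⁻¹-involutive (f i))))

      k : Fin n
      k = proj₁ (f-surjective ι)
      fk≈ι : f k ≈ ι
      fk≈ι = proj₂ (f-surjective ι)

      opposite-k : k ≡ opposite k
      opposite-k = f-injective (trans fk≈ι (trans (inverseʳ-unique ι ι (proj₂ ι-involution))
        (trans (⁻¹-cong (sym fk≈ι)) (sym (f-opposite k)))))

      lower upper middle : Fin n → Carrier
      lower  i = if does (i Fin.<? opposite i) then f i else ε
      upper  i = if does (opposite i Fin.<? i) then f i else ε
      middle i = if does (i Fin.≟ k) then ι else ε

      fixed⇒ι : ∀ {i} → i ≡ opposite i → ¬ f i ≈ ε → f i ≈ ι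
      fixed⇒ι {i} i≡o fi≉ε = unique (fi≉ε , trans (∙-congˡ (trans (reflexive (≡.cong f i≡o)) (f-opposite i))) (inverseʳ _))

      -- Indices are sorted by whether they precede or follow the index of the negative. The only
      -- self-opposite elements are 0 and ι: the first contributes nothing, the second is the term
      -- in `middle`.
      decompose : ∀ i → f i ≈ lower i ∙ upper i ∙ middle i
      decompose i with Fin.<-cmp i (opposite i)
      ... | tri< i<o i≢o o≮i
        rewrite dec-true (i Fin.<? opposite i) i<o | dec-false (opposite i Fin.<? i) o≮i
              | dec-false (i Fin.≟ k) (λ { ≡.refl → i≢o opposite-k })
              = sym (trans (identityʳ _) (identityʳ _))
      ... | tri> i≮o i≢o o<i
        rewrite dec-false (i Fin.<? opposite i) i≮o | dec-true (opposite i Fin.<? i) o<i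
              | dec-false (i Fin.≟ k) (λ { ≡.refl → i≢o opposite-k })
              = sym (trans (identityʳ _) (identityˡ _))
      ... | tri≈ i≮o i≡o o≮i with ε? (f i)
      ...   | yes fi≈ε
        rewrite dec-false (i Fin.<? opposite i) i≮o | dec-false (opposite i Fin.<? i) o≮i
              | dec-false (i Fin.≟ k) (λ { ≡.refl → proj₁ ι-involution (trans (sym fk≈ι) fi≈ε) })
              = trans fi≈ε (sym (trans (identityʳ _) (identityʳ _)))
      ...   | no fi≉ε
        rewrite dec-false (i Fin.<? opposite i) i≮o | dec-false (opposite i Fin.<? i) o≮i
              | dec-true (i Fin.≟ k) (f-injective (trans (fixed⇒ι i≡o fi≉ε) (sym fk≈ι)))
              = trans (fixed⇒ι i≡o fi≉ε) (sym (trans (∙-congʳ (identityʳ _)) (identityˡ _)))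

      -- `opposite` exchanges the two strict inequalities, so reindexing `upper` along it puts -g
      -- beside each g counted in `lower`.
      cancel : ∀ i → lower i ∙ upper (opposite i) ≈ ε
      cancel i rewrite opposite-opposite i with does (i Fin.<? opposite i)
      ... | true  = trans (∙-congˡ (f-opposite i)) (inverseʳ _)
      ... | false = identityˡ ε

    sum-all≈involution : sumΓ Γ n f ≈ ι
    sum-all≈involution = begin
      sumΓ Γ n f                                      ≈⟨ sumΓ≈sum n f ⟩
      sum f                                           ≈⟨ sum-cong-≋ decompose ⟩
      sum (λ i → lower i ∙ upper i ∙ middle i)        ≈⟨ ∑-distrib-+ (λ i → lower i ∙ upper i) middle ⟩
      sum (λ i → lower i ∙ upper i) ∙ sum middle      ≈⟨ ∙-cong (∑-distrib-+ lower upper) (sum-indicator k ι) ⟩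
      sum lower ∙ sum upper ∙ ι                       ≈⟨ ∙-congʳ (∙-congˡ (sum-permute upper
                                                           (permutation opposite opposite opposite-opposite opposite-opposite))) ⟩
      sum lower ∙ sum (upper ∘ opposite) ∙ ι          ≈⟨ ∙-congʳ (∑-distrib-+ lower (upper ∘ opposite)) ⟨
      sum (λ i → lower i ∙ upper (opposite i)) ∙ ι    ≈⟨ ∙-congʳ (trans (sum-cong-≋ cancel) (sum-replicate-zero n)) ⟩
      ε ∙ ι                                           ≈⟨ identityˡ ι ⟩
      ι                                               ∎

-- Subgroups of a finite abelian group

least : ∀ {p} {P : ℕ → Set p} → (∀ n → Dec (P n)) → ∀ n → P n →
        ∃ λ m → P m × (∀ {k} → k < m → ¬ P k)
least P? zero    Pn = zero , Pn , λ ()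
least {P = P} P? (suc n) Pn with P? 0
... | yes P0 = 0 , P0 , λ ()
... | no ¬P0 with least (P? ∘ suc) n Pn
...   | m , Pm , below = suc m , Pm , λ { {zero} _ → ¬P0 ; {suc k} (s≤s k<m) → below k<m }

-- The pair (a , i) stands for a·g plus the i-th element of a subgroup H, where (r + 1)·g is the
-- element of H of index u.
module _ (r : ℕ) {k : ℕ} (add : Fin k → Fin k → Fin k) (u : Fin k) where
  addDigits : Fin (suc r) × Fin k → Fin (suc r) × Fin k → Fin (suc r) × Fin k
  addDigits (a , i) (b , j) with toℕ a + toℕ b ℕ.<? suc r
  ... | yes a+b<r = fromℕ< a+b<r , add i j
  ... | no  a+b≮r = fromℕ< (ℕ.m<n+o⇒m∸n<o (toℕ a + toℕ b) (suc r)
                      (ℕ.+-mono-< (Fin.toℕ<n a) (Fin.toℕ<n b))) , add u (add i j)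

  extendAdd : Fin (suc r * k) → Fin (suc r * k) → Fin (suc r * k)
  extendAdd x y = uncurry combine (addDigits (remQuot k x) (remQuot k y))

module FiniteAbelianGroup {c ℓ : Level} (Γ : AbelianGroup c ℓ) {N : ℕ} (order : HasOrder Γ N) where
  open AbelianGroup Γ
  open import Algebra.Properties.CommutativeMonoid.Mult commutativeMonoid
    renaming (_×_ to _·_) public
  open import Algebra.Properties.Group group
    using (inverseʳ-unique; ∙-cancelʳ; ∙-cancelˡ; ⁻¹-involutive)
  open import Relation.Binary.Reasoning.Setoid setoid
  open AbelianGroupSolver Γ
  open Bijection order using () renaming (to to element; injective to element-injective) public

  indexOf : Carrier → Fin N
  indexOf g = proj₁ (Bijection.surjective order g)

  element-indexOf : ∀ g → element (indexOf g) ≈ g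
  element-indexOf g = proj₂ (Bijection.surjective order g) ≡.refl

  indexOf-injective : ∀ {g h} → indexOf g ≡ indexOf h → g ≈ h
  indexOf-injective {g} {h} eq = begin
    g                    ≈⟨ element-indexOf g ⟨
    element (indexOf g)  ≡⟨ ≡.cong element eq ⟩
    element (indexOf h)  ≈⟨ element-indexOf h ⟩
    h                    ∎

  indexOf-cong : ∀ {g h} → g ≈ h → indexOf g ≡ indexOf h
  indexOf-cong {g} {h} eq = element-injective (trans (element-indexOf g) (trans eq (sym (element-indexOf h))))

  indexOf-element : ∀ i → indexOf (element i) ≡ i
  indexOf-element i = element-injective (element-indexOf (element i))

  infix 4 _≟_
  _≟_ : Decidable _≈_
  g ≟ h = map′ indexOf-injective indexOf-cong (indexOf g Fin.≟ indexOf h)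

  search : ∀ {p} {P : Carrier → Set p} → (∀ {g h} → g ≈ h → P g → P h) →
           (∀ g → Dec (P g)) → Dec (∃ P)
  search P-resp P? = map′ (λ (i , Pi) → element i , Pi)
    (λ (g , Pg) → indexOf g , P-resp (sym (element-indexOf g)) Pg)
    (Fin.any? (P? ∘ element))

  -- Two of the N + 1 multiples 0·g, ..., N·g coincide by the pigeonhole principle, and cancelling
  -- the smaller one leaves a positive multiple equal to 0.
  torsion : ∀ g → ∃ λ k → suc k · g ≈ ε
  torsion g with Fin.pigeonhole (ℕ.n<1+n N) (λ i → indexOf (toℕ i · g))
  ... | i , j , i<j , eq with ℕ.m≤n⇒∃[o]m+o≡n i<j
  ...   | k , i+k≡j = k , sym (∙-cancelˡ (toℕ i · g) _ _ (begin
    toℕ i · g ∙ ε              ≈⟨ identityʳ _ ⟩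
    toℕ i · g                  ≈⟨ indexOf-injective eq ⟩
    toℕ j · g                  ≡⟨ ≡.cong (_· g) (≡.trans (ℕ.+-suc (toℕ i) k) i+k≡j) ⟨
    (toℕ i + suc k) · g        ≈⟨ ×-homo-+ g (toℕ i) (suc k) ⟩
    toℕ i · g ∙ suc k · g      ∎))

  -- Addition is recorded on indices, so that the law of a subgroup built by successive extensions
  -- is an explicit table that can be evaluated.
  record Subgroup : Set (c ⊔ ℓ) where
    field
      size            : ℕ
      embed           : Fin size → Carrier
      embed-injective : ∀ {i j} → embed i ≈ embed j → i ≡ j
      unit            : Fin size
      embed-unit      : embed unit ≈ ε
      add             : Fin size → Fin size → Fin size
      embed-add       : ∀ i j → embed (add i j) ≈ embed i ∙ embed j
  open Subgroup public

  infix 4 _∈_ _∉_ _∈?_ _⊆_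
  _∈_ _∉_ : Carrier → Subgroup → Set ℓ
  g ∈ H = ∃ λ i → embed H i ≈ g
  g ∉ H = ¬ g ∈ H

  _⊆_ : Subgroup → Subgroup → Set (c ⊔ ℓ)
  H ⊆ K = ∀ {g} → g ∈ H → g ∈ K

  _∈?_ : ∀ g H → Dec (g ∈ H)
  g ∈? H = Fin.any? (λ i → embed H i ≟ g)

  module _ (H : Subgroup) where
    embed-∈ : ∀ i → embed H i ∈ H
    embed-∈ i = i , refl

    ∈-resp : ∀ {g h} → g ≈ h → g ∈ H → h ∈ H
    ∈-resp g≈h (i , eq) = i , trans eq g≈h

    ∈-ε : ε ∈ H
    ∈-ε = unit H , embed-unit H

    ∈-∙ : ∀ {g h} → g ∈ H → h ∈ H → g ∙ h ∈ H
    ∈-∙ (i , p) (j , q) = add H i j , trans (embed-add H i j) (∙-cong p q)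

    ∈-· : ∀ n {g} → g ∈ H → n · g ∈ H
    ∈-· zero    g∈H = ∈-ε
    ∈-· (suc n) g∈H = ∈-∙ g∈H (∈-· n g∈H)

    -- Since Γ is torsion, -g is one of the multiples of g.
    ∈-⁻¹ : ∀ {g} → g ∈ H → g ⁻¹ ∈ H
    ∈-⁻¹ {g} g∈H with torsion g
    ... | k , eq = ∈-resp (inverseʳ-unique g (k · g) eq) (∈-· k g∈H)

    difference : ∀ {g} x y a b → 1 + y * b ≡ x * a → x · (a · g) ∙ (y · (b · g)) ⁻¹ ≈ g
    difference {g} x y a b eq = begin
      x · (a · g) ∙ (y · (b · g)) ⁻¹        ≈⟨ ∙-congʳ (×-assocˡ g x a) ⟩
      (x * a) · g ∙ (y · (b · g)) ⁻¹        ≡⟨ ≡.cong (λ k → k · g ∙ (y · (b · g)) ⁻¹) eq ⟨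
      g ∙ (y * b) · g ∙ (y · (b · g)) ⁻¹    ≈⟨ ∙-congˡ (⁻¹-cong (×-assocˡ g y b)) ⟩
      g ∙ (y * b) · g ∙ ((y * b) · g) ⁻¹    ≈⟨ assoc _ _ _ ⟩
      g ∙ ((y * b) · g ∙ ((y * b) · g) ⁻¹)  ≈⟨ ∙-congˡ (inverseʳ _) ⟩
      g ∙ ε                                 ≈⟨ identityʳ g ⟩
      g                                     ∎

    -- Bézout's identity writes g as a difference of multiples of `a · g` and `b · g`.
    ∈-coprime : ∀ {a b g} → Coprime a b → a · g ∈ H → b · g ∈ H → g ∈ H
    ∈-coprime {a} {b} {g} cop ag∈H bg∈H with coprime-Bézout cop
    ... | Bézout.+- x y eq = ∈-resp (difference x y a b eq) (∈-∙ (∈-· x ag∈H) (∈-⁻¹ (∈-· y bg∈H)))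
    ... | Bézout.-+ x y eq = ∈-resp (difference y x b a eq) (∈-∙ (∈-· y bg∈H) (∈-⁻¹ (∈-· x ag∈H)))

    -- m is one less than the order of g modulo H, so that a positive order needs no side condition.
    module Extension (g : Carrier) (m : ℕ) (u : Fin (size H)) (embed-u : embed H u ≈ suc m · g)
                     (minimal : ∀ {k} → k < m → suc k · g ∉ H) where
      private
        k = size H
        value : Fin (suc m) × Fin k → Carrier
        value (a , i) = toℕ a · g ∙ embed H i

        -- With `a` below `b` the equation would place (b - a)·g in H, although b - a is positive
        -- and at most `m`.
        value-≤ : ∀ a i b j → value (a , i) ≈ value (b , j) → ¬ toℕ a < toℕ b
        value-≤ a i b j eq a<b with ℕ.m≤n⇒∃[o]m+o≡n a<b
        ... | d , a+d≡b = minimal d<m (∈-resp d·g≈ (∈-∙ (embed-∈ i) (∈-⁻¹ (embed-∈ j))))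
          where
          b≡a+d : toℕ a + suc d ≡ toℕ b
          b≡a+d = ≡.trans (ℕ.+-suc (toℕ a) d) a+d≡b
          d<m : d < m
          d<m = ℕ.≤-pred (ℕ.≤-trans (s≤s (ℕ.≤-trans (ℕ.m≤n+m (suc d) (toℕ a)) (ℕ.≤-reflexive b≡a+d)))
                                    (Fin.toℕ<n b))
          d·g≈ : embed H i ∙ embed H j ⁻¹ ≈ suc d · g
          d·g≈ = begin
            embed H i ∙ embed H j ⁻¹
              ≈⟨ solve (toℕ a · g ∷ embed H i ∷ embed H j ∷ [])
                   (var 1F ⊕ ⊝ var 2F) ((⊝ var 0F) ⊕ (var 0F ⊕ var 1F) ⊕ ⊝ var 2F) ≡.refl ⟩
            (toℕ a · g) ⁻¹ ∙ (value (a , i) ∙ embed H j ⁻¹)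
              ≈⟨ ∙-congˡ (∙-congʳ eq) ⟩
            (toℕ a · g) ⁻¹ ∙ (toℕ b · g ∙ embed H j ∙ embed H j ⁻¹)
              ≡⟨ ≡.cong (λ n → (toℕ a · g) ⁻¹ ∙ (n · g ∙ embed H j ∙ embed H j ⁻¹)) b≡a+d ⟨
            (toℕ a · g) ⁻¹ ∙ ((toℕ a + suc d) · g ∙ embed H j ∙ embed H j ⁻¹)
              ≈⟨ ∙-congˡ (∙-congʳ (∙-congʳ (×-homo-+ g (toℕ a) (suc d)))) ⟩
            (toℕ a · g) ⁻¹ ∙ (toℕ a · g ∙ suc d · g ∙ embed H j ∙ embed H j ⁻¹)
              ≈⟨ solve (toℕ a · g ∷ suc d · g ∷ embed H j ∷ [])
                   ((⊝ var 0F) ⊕ (((var 0F ⊕ var 1F) ⊕ var 2F) ⊕ ⊝ var 2F)) (var 1F) ≡.refl ⟩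
            suc d · g ∎

        value-injective : ∀ p q → value p ≈ value q → p ≡ q
        value-injective (a , i) (b , j) eq with ℕ.<-cmp (toℕ a) (toℕ b)
        ... | tri< a<b _ _ = contradiction a<b (value-≤ a i b j eq)
        ... | tri> _ _ b<a = contradiction b<a (value-≤ b j a i (sym eq))
        ... | tri≈ _ a≡b _ with Fin.toℕ-injective a≡b
        ...   | ≡.refl = ≡.cong (a ,_) (embed-injective H (∙-cancelˡ _ _ _ eq))

        value-remQuot : Fin (suc m * k) → Carrier
        value-remQuot = value ∘ remQuot {suc m} k

        value-combine : ∀ a i → value-remQuot (combine a i) ≈ value (a , i)
        value-combine a i = reflexive (≡.cong value (Fin.remQuot-combine a i))

        -- This is addition with carry: when the digits reach `suc m`, the multiple `suc m · g`
        -- moves into H as the element of index `u`.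
        value-add : ∀ p q → value (addDigits m (add H) u p q) ≈ value p ∙ value q
        value-add (a , i) (b , j) with toℕ a + toℕ b ℕ.<? suc m
        ... | yes lt = begin
          toℕ (fromℕ< lt) · g ∙ embed H (add H i j)            ≡⟨ ≡.cong (λ n → n · g ∙ _) (Fin.toℕ-fromℕ< lt) ⟩
          (toℕ a + toℕ b) · g ∙ embed H (add H i j)            ≈⟨ ∙-cong (×-homo-+ g (toℕ a) (toℕ b)) (embed-add H i j) ⟩
          toℕ a · g ∙ toℕ b · g ∙ (embed H i ∙ embed H j)
            ≈⟨ solve (toℕ a · g ∷ toℕ b · g ∷ embed H i ∷ embed H j ∷ [])
                 ((var 0F ⊕ var 1F) ⊕ (var 2F ⊕ var 3F)) ((var 0F ⊕ var 2F) ⊕ (var 1F ⊕ var 3F)) ≡.refl ⟩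
          value (a , i) ∙ value (b , j)                        ∎
        ... | no ≮r = begin
          toℕ (fromℕ< lt) · g ∙ embed H (add H u (add H i j))                 ≡⟨ ≡.cong (λ n → n · g ∙ _) (Fin.toℕ-fromℕ< lt) ⟩
          (toℕ a + toℕ b ∸ suc m) · g ∙ embed H (add H u (add H i j))
            ≈⟨ ∙-congˡ (trans (embed-add H u _) (∙-cong embed-u (embed-add H i j))) ⟩
          (toℕ a + toℕ b ∸ suc m) · g ∙ (suc m · g ∙ (embed H i ∙ embed H j)) ≈⟨ assoc _ _ _ ⟨
          (toℕ a + toℕ b ∸ suc m) · g ∙ suc m · g ∙ (embed H i ∙ embed H j)
            ≈⟨ ∙-congʳ (×-homo-+ g (toℕ a + toℕ b ∸ suc m) (suc m)) ⟨
          (toℕ a + toℕ b ∸ suc m + suc m) · g ∙ (embed H i ∙ embed H j)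
            ≡⟨ ≡.cong (λ n → n · g ∙ (embed H i ∙ embed H j)) (ℕ.m∸n+n≡m (ℕ.≮⇒≥ ≮r)) ⟩
          (toℕ a + toℕ b) · g ∙ (embed H i ∙ embed H j)        ≈⟨ ∙-congʳ (×-homo-+ g (toℕ a) (toℕ b)) ⟩
          toℕ a · g ∙ toℕ b · g ∙ (embed H i ∙ embed H j)
            ≈⟨ solve (toℕ a · g ∷ toℕ b · g ∷ embed H i ∷ embed H j ∷ [])
                 ((var 0F ⊕ var 1F) ⊕ (var 2F ⊕ var 3F)) ((var 0F ⊕ var 2F) ⊕ (var 1F ⊕ var 3F)) ≡.refl ⟩
          value (a , i) ∙ value (b , j)                        ∎
          where
          lt = ℕ.m<n+o⇒m∸n<o (toℕ a + toℕ b) (suc m) (ℕ.+-mono-< (Fin.toℕ<n a) (Fin.toℕ<n b))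

      extension : Subgroup
      extension = record
        { size            = suc m * k
        ; embed           = value-remQuot
        ; embed-injective = λ {x} {y} eq → ≡.trans (≡.sym (Fin.combine-remQuot {suc m} k x))
            (≡.trans (≡.cong (uncurry combine) (value-injective (remQuot k x) (remQuot k y) eq)) (Fin.combine-remQuot {suc m} k y))
        ; unit            = combine {suc m} zero (unit H)
        ; embed-unit      = trans (value-combine zero (unit H)) (trans (identityˡ _) (embed-unit H))
        ; add             = extendAdd m (add H) u
        ; embed-add       = λ x y → trans (uncurry value-combine (addDigits m (add H) u (remQuot k x) (remQuot k y)))
                                     (value-add (remQuot k x) (remQuot k y))
        }

      H⊆extension : H ⊆ extension
      H⊆extension (i , eq) = combine {suc m} zero i , trans (value-combine zero i) (trans (identityˡ _) eq)

      -- Modulo H every element of the extension is a multiple of g, which `suc m` annihilates.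
      suc-m·extension : ∀ {x} → x ∈ extension → suc m · x ∈ H
      suc-m·extension (i , eq) = ∈-resp (×-congʳ (suc m) eq) (go (remQuot {suc m} k i))
        where
        go : ∀ p → suc m · value p ∈ H
        go (a , i) = ∈-resp (sym (×-distrib-+ (toℕ a · g) (embed H i) (suc m)))
          (∈-∙ (∈-resp (trans (×-assocˡ g (toℕ a) (suc m)) (trans (reflexive (≡.cong (_· g) (ℕ.*-comm (toℕ a) (suc m)))) (sym (×-assocˡ g (suc m) (toℕ a)))))
                  (∈-· (toℕ a) (u , embed-u)))
               (∈-· (suc m) (embed-∈ i)))

  -- Lagrange's and Cauchy's theorems for quotients

  trivial : Subgroup
  trivial = record
    { size = 1 ; embed = λ _ → ε ; embed-injective = λ { {0F} {0F} _ → ≡.refl }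
    ; unit = 0F ; embed-unit = refl ; add = λ _ _ → 0F ; embed-add = λ _ _ → sym (identityˡ ε) }

  size-positive : ∀ H → 0 < size H
  size-positive H = ℕ.≤-trans (s≤s z≤n) (Fin.toℕ<n (unit H))

  size≤N : ∀ H → size H ≤ N
  size≤N H = Fin.injective⇒≤ {f = λ i → indexOf (embed H i)} (λ eq → embed-injective H (indexOf-injective eq))

  N≤size : ∀ H → (∀ g → g ∈ H) → N ≤ size H
  N≤size H full = Fin.injective⇒≤ {f = λ i → proj₁ (full (element i))} (λ {i} {j} eq → element-injective (begin
    element i                            ≈⟨ proj₂ (full (element i)) ⟨
    embed H (proj₁ (full (element i)))   ≡⟨ ≡.cong (embed H) eq ⟩
    embed H (proj₁ (full (element j)))   ≈⟨ proj₂ (full (element j)) ⟩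
    element j                            ∎))

  full? : ∀ H → (∀ g → g ∈ H) ⊎ ∃ (_∉ H)
  full? H with search (λ g≈h g∉H h∈H → g∉H (∈-resp H (sym g≈h) h∈H)) (λ g → ¬? (g ∈? H))
  ... | yes outside = inj₂ outside
  ... | no  none    = inj₁ (λ g → decidable-stable (g ∈? H) (λ g∉H → none (g , g∉H)))

  -- A positive multiplier below a prime is coprime to it, so if both multiples of g lay in H, g
  -- would too. Hence the order of g modulo H is the prime itself.
  minimal-prime : ∀ H {g m} → Prime (suc m) → suc m · g ∈ H → g ∉ H → ∀ {k} → k < m → suc k · g ∉ H
  minimal-prime H p qg∈H g∉H k<m kg∈H = g∉H (∈-coprime H (prime⇒coprime p (s≤s k<m)) qg∈H kg∈H)

  -- These are Lagrange's and Cauchy's theorems for Γ/H, expressed through H so that no quotient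
  -- group has to be formed. They are bundled because all are proved along the same chain of
  -- subgroups.
  record Index (H : Subgroup) : Set (c ⊔ ℓ) where
    field
      index       : ℕ
      index*size  : index * size H ≡ N
      annihilates : ∀ g → index · g ∈ H
      cauchy      : ∀ {q} → Prime q → q ∣ index → ∃ λ g → g ∉ H × q · g ∈ H
  open Index public

  -- Induction on `N ∸ size H`: an element outside H, with its order modulo H, gives a larger
  -- subgroup, and the index of H is the index of that subgroup times this order.
  indexed : ∀ H → Index H
  indexed H = go H (<-wellFounded _)
    where
    go : ∀ H → Acc _<_ (N ∸ size H) → Index H
    go H (acc rec) with full? H
    ... | inj₁ full = record
      { index       = 1
      ; index*size  = ≡.trans (ℕ.*-identityˡ _) (ℕ.≤-antisym (size≤N H) (N≤size H full))
      ; annihilates = λ g → full (1 · g)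
      ; cauchy      = λ q-prime q∣1 → contradiction (≡.subst Prime (∣1⇒≡1 q∣1) q-prime) ¬prime[1]
      }
    ... | inj₂ (g , g∉H) with least (λ k → suc k · g ∈? H) (proj₁ (torsion g))
                                    (∈-resp H (sym (proj₂ (torsion g))) (∈-ε H))
    ...   | m , (u , embed-u) , minimal = record
      { index       = index I * suc m
      ; index*size  = ≡.trans (ℕ.*-assoc (index I) (suc m) (size H)) (index*size I)
      ; annihilates = λ x → ∈-resp H
          (trans (×-assocˡ x (suc m) (index I)) (×-congˡ (ℕ.*-comm (suc m) (index I))))
          (suc-m·extension (annihilates I x))
      ; cauchy      = descend
      }
      where
      open Extension H g m u embed-u minimal
      1<suc-m : 1 < suc m
      1<suc-m = s≤s (ℕ.n≢0⇒n>0 λ { ≡.refl → g∉H (∈-resp H (identityʳ g) (u , embed-u)) })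
      grows : size H < size extension
      grows = ℕ.<-≤-trans (ℕ.m<m*n (size H) (suc m) ⦃ ℕ.>-nonZero (size-positive H) ⦄ 1<suc-m)
                          (ℕ.≤-reflexive (ℕ.*-comm (size H) (suc m)))
      I : Index extension
      I = go extension (rec (ℕ.∸-monoʳ-< grows (size≤N extension)))

      -- If q divides the order `suc m` of g modulo H, the cofactor times g has order q. Otherwise q
      -- divides the index of the extension; an element of order q modulo the extension is
      -- multiplied by `suc m`, which brings its q-th multiple into H, while coprimality keeps the
      -- product itself outside H.
      descend : ∀ {q} → Prime q → q ∣ index I * suc m → ∃ λ g → g ∉ H × q · g ∈ H
      descend {q} q-prime q∣ with q ∣? suc m
      ... | yes (divides zero ())
      ... | yes (divides (suc r) m≡) = suc r · g , minimal r<m , qrg∈H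
        where
        r<m : r < m
        r<m = ℕ.≤-pred (ℕ.<-≤-trans (ℕ.m<m*n (suc r) q (ℕ.nonTrivial⇒n>1 q ⦃ prime⇒nonTrivial q-prime ⦄))
                                    (ℕ.≤-reflexive (≡.sym m≡)))
        qrg∈H : q · (suc r · g) ∈ H
        qrg∈H = ∈-resp H (trans (×-congˡ (≡.trans m≡ (ℕ.*-comm (suc r) q))) (sym (×-assocˡ g q (suc r)))) (u , embed-u)
      ... | no q∤m with euclidsLemma (index I) (suc m) q-prime q∣
      ...   | inj₂ q∣m = contradiction q∣m q∤m
      ...   | inj₁ q∣I with cauchy I q-prime q∣I
      ...     | g₁ , g₁∉ , qg₁∈ = suc m · g₁
              , (λ rg₁∈H → g₁∉ (∈-coprime extension coprime qg₁∈ (H⊆extension rg₁∈H)))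
              , ∈-resp H (trans (×-assocˡ g₁ (suc m) q) (trans (×-congˡ (ℕ.*-comm (suc m) q)) (sym (×-assocˡ g₁ q (suc m))))) (suc-m·extension qg₁∈)
        where
        coprime : Coprime q (suc m)
        coprime {d} (d∣q , d∣m) with prime⇒irreducible q-prime d∣q
        ... | inj₁ d≡1 = d≡1
        ... | inj₂ ≡.refl = contradiction d∣m q∤m

  -- Cauchy's theorem is applied once for each prime: adjoining an element of prime order modulo H
  -- multiplies the size by that prime and divides the index by it.
  grow : ∀ {ps} → All Prime ps → ∀ H → product ps ∣ index (indexed H) →
         ∃ λ K → H ⊆ K × size K ≡ product ps * size H
  grow [] H _ = H , (λ g∈H → g∈H) , ≡.sym (ℕ.*-identityˡ (size H))
  grow {zero ∷ ps} (p ∷ _) H _ = contradiction p ¬prime[0]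
  grow {suc m ∷ ps} (p ∷ primes) H divides-index
    with cauchy (indexed H) p (∣-trans (m∣m*n (product ps)) divides-index)
  ... | g , g∉H , (u , embed-u) = enlarge (grow primes extension rest)
    where
    open Extension H g m u embed-u (minimal-prime H p (u , embed-u) g∉H)
    index≡ : index (indexed H) ≡ suc m * index (indexed extension)
    index≡ = ℕ.*-cancelʳ-≡ _ _ (size H) ⦃ ℕ.>-nonZero (size-positive H) ⦄ (≡.trans (index*size (indexed H))
      (≡.trans (≡.sym (index*size (indexed extension))) (rearrange (index (indexed extension)) (suc m) (size H))))
      where
      rearrange : ∀ i q k → i * (q * k) ≡ q * i * k
      rearrange = solve-∀
    rest : product ps ∣ index (indexed extension)
    rest = *-cancelˡ-∣ (suc m) (≡.subst (suc m * product ps ∣_) index≡ divides-index)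
    enlarge : ∃ (λ K → extension ⊆ K × size K ≡ product ps * size extension) →
              ∃ (λ K → H ⊆ K × size K ≡ suc m * product ps * size H)
    enlarge (K , extension⊆K , size≡) = K , (λ x → extension⊆K (H⊆extension x)) ,
      ≡.trans size≡ (rearrange (product ps) (suc m) (size H))
      where
      rearrange : ∀ n q k → n * (q * k) ≡ q * n * k
      rearrange = solve-∀

  -- Symmetric systems of coset representatives in quotients without elements of order 2

  data Coset (H : Subgroup) {l} (X : Vec Carrier l) (g : Carrier) : Set ℓ where
    centre : ∀ h → g ≈ embed H h → Coset H X g
    plus   : ∀ i h → g ≈ lookup X i ∙ embed H h → Coset H X g
    minus  : ∀ i h → g ≈ lookup X i ⁻¹ ∙ embed H h → Coset H X g

  module Transversal (H K : Subgroup) (H⊆K : H ⊆ K)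
                     (halve : ∀ {g} → g ∙ g ∈ H → g ∈ H) where

    Covered : ∀ {n} → (Fin n → Carrier) → Carrier → Set ℓ
    Covered R g = ∃ λ i → g ∙ R i ⁻¹ ∈ H

    covered? : ∀ {n} (R : Fin n → Carrier) g → Dec (Covered R g)
    covered? R g = Fin.any? (λ i → g ∙ R i ⁻¹ ∈? H)

    Distinct : ∀ {n} → (Fin n → Carrier) → Set ℓ
    Distinct R = ∀ i j → R i ∙ R j ⁻¹ ∈ H → i ≡ j

    ∈-swap : ∀ {x y} → x ∙ y ⁻¹ ∈ H → y ∙ x ⁻¹ ∈ H
    ∈-swap {x} {y} p = ∈-resp H (solve (x ∷ y ∷ []) (⊝ (var 0F ⊕ ⊝ var 1F)) (var 1F ⊕ ⊝ var 0F) ≡.refl) (∈-⁻¹ H p)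

    Distinct-∷ : ∀ {n x} {R : Fin n → Carrier} → ¬ Covered R x → Distinct R → Distinct (x Vector.∷ R)
    Distinct-∷ x∉R distinct zero    zero    _ = ≡.refl
    Distinct-∷ x∉R distinct zero    (suc j) p = contradiction (j , p) x∉R
    Distinct-∷ x∉R distinct (suc i) zero    p = contradiction (i , ∈-swap p) x∉R
    Distinct-∷ x∉R distinct (suc i) (suc j) p = ≡.cong suc (distinct i j p)

    module _ {n} (R : Fin n → Carrier) where
      -- The cosets `R i` + H are disjoint and contained in K, so their elements can be counted
      -- inside K.
      distinct⇒≤ : Distinct R → (∀ i → R i ∈ K) → n * size H ≤ size K
      distinct⇒≤ distinct R∈K = Fin.injective⇒≤ {f = λ x → proj₁ (value∈K (remQuot (size H) x))} λ {x} {y} eq →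
        ≡.trans (≡.sym (Fin.combine-remQuot {n} (size H) x)) (≡.trans (≡.cong (uncurry combine)
          (value-injective (remQuot (size H) x) (remQuot (size H) y) (begin
            value (remQuot (size H) x)                    ≈⟨ proj₂ (value∈K (remQuot (size H) x)) ⟨
            embed K (proj₁ (value∈K (remQuot (size H) x))) ≡⟨ ≡.cong (embed K) eq ⟩
            embed K (proj₁ (value∈K (remQuot (size H) y))) ≈⟨ proj₂ (value∈K (remQuot (size H) y)) ⟩
            value (remQuot (size H) y)                    ∎)))
          (Fin.combine-remQuot {n} (size H) y))
        where
        value : Fin n × Fin (size H) → Carrier
        value (i , h) = R i ∙ embed H h
        value∈K : ∀ p → value p ∈ K
        value∈K (i , h) = ∈-∙ K (R∈K i) (H⊆K (embed-∈ H h))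
        value-injective : ∀ p q → value p ≈ value q → p ≡ q
        value-injective (i , h) (j , h′) eq with distinct i j (∈-resp H quotient≈ (∈-∙ H (embed-∈ H h′) (∈-⁻¹ H (embed-∈ H h))))
          where
          quotient≈ : embed H h′ ∙ embed H h ⁻¹ ≈ R i ∙ R j ⁻¹
          quotient≈ = begin
            embed H h′ ∙ embed H h ⁻¹
              ≈⟨ solve (R j ∷ embed H h ∷ embed H h′ ∷ [])
                   (var 2F ⊕ ⊝ var 1F) ((var 0F ⊕ var 2F) ⊕ ⊝ (var 0F ⊕ var 1F)) ≡.refl ⟩
            R j ∙ embed H h′ ∙ (R j ∙ embed H h) ⁻¹
              ≈⟨ ∙-congʳ eq ⟨
            R i ∙ embed H h ∙ (R j ∙ embed H h) ⁻¹
              ≈⟨ solve (R i ∷ R j ∷ embed H h ∷ [])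
                   ((var 0F ⊕ var 2F) ⊕ ⊝ (var 1F ⊕ var 2F)) (var 0F ⊕ ⊝ var 1F) ≡.refl ⟩
            R i ∙ R j ⁻¹ ∎
        ... | ≡.refl = ≡.cong (i ,_) (embed-injective H (∙-cancelˡ _ _ _ eq))

      -- An element of K is determined by a representative covering it and its difference from that
      -- representative.
      covering⇒≥ : (∀ k → Covered R (embed K k)) → size K ≤ n * size H
      covering⇒≥ covered = Fin.injective⇒≤ {f = code} λ {k} {k′} eq →
        embed-injective K (same (Fin.combine-injective _ _ _ _ eq))
        where
        code : Fin (size K) → Fin (n * size H)
        code k = combine (proj₁ (covered k)) (proj₁ (proj₂ (covered k)))
        same : ∀ {k k′} → proj₁ (covered k) ≡ proj₁ (covered k′) ×
                          proj₁ (proj₂ (covered k)) ≡ proj₁ (proj₂ (covered k′)) → embed K k ≈ embed K k′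
        same {k} {k′} eqs with covered k | covered k′
        same {k} {k′} (≡.refl , ≡.refl) | i , h , p | .i , .h , q = ∙-cancelʳ (R i ⁻¹) _ _ (trans (sym p) q)

    representatives : ∀ {l} → Vec Carrier l → Fin (suc (l * 2)) → Carrier
    representatives []      = λ _ → ε
    representatives (x ∷ X) = x Vector.∷ x ⁻¹ Vector.∷ representatives X

    covered-⁻¹ : ∀ {l g} (X : Vec Carrier l) → Covered (representatives X) g → Covered (representatives X) (g ⁻¹)
    covered-⁻¹ {g = g} [] (i , p) = i , ∈-resp H (solve (g ∷ []) (⊝ (var 0F ⊕ ⊝ 𝟘)) (⊝ var 0F ⊕ ⊝ 𝟘) ≡.refl) (∈-⁻¹ H p)
    covered-⁻¹ {g = g} (x ∷ X) (0F , p) = 1F , ∈-resp H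
      (solve (g ∷ x ∷ []) (⊝ (var 0F ⊕ ⊝ var 1F)) (⊝ var 0F ⊕ ⊝ ⊝ var 1F) ≡.refl) (∈-⁻¹ H p)
    covered-⁻¹ {g = g} (x ∷ X) (1F , p) = 0F , ∈-resp H
      (solve (g ∷ x ∷ []) (⊝ (var 0F ⊕ ⊝ ⊝ var 1F)) (⊝ var 0F ⊕ ⊝ var 1F) ≡.refl) (∈-⁻¹ H p)
    covered-⁻¹ (x ∷ X) (suc (suc i) , p) with covered-⁻¹ X (i , p)
    ... | j , q = suc (suc j) , q

    covered-H : ∀ {l g} (X : Vec Carrier l) → g ∈ H → Covered (representatives X) g
    covered-H {g = g} [] p = 0F , ∈-resp H (solve (g ∷ []) (var 0F) (var 0F ⊕ ⊝ 𝟘) ≡.refl) p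
    covered-H (x ∷ X) p with covered-H X p
    ... | j , q = suc (suc j) , q

    coset : ∀ {l g} (X : Vec Carrier l) → Covered (representatives X) g → Coset H X g
    coset {g = g} [] (_ , h , eq) = centre h (trans (solve (g ∷ []) (var 0F) (var 0F ⊕ ⊝ 𝟘) ≡.refl) (sym eq))
    coset {g = g} (x ∷ X) (0F , h , eq) = plus 0F h (trans
      (solve (g ∷ x ∷ []) (var 0F) (var 1F ⊕ (var 0F ⊕ ⊝ var 1F)) ≡.refl) (∙-congˡ (sym eq)))
    coset {g = g} (x ∷ X) (1F , h , eq) = minus 0F h (trans
      (solve (g ∷ x ∷ []) (var 0F) (⊝ var 1F ⊕ (var 0F ⊕ ⊝ ⊝ var 1F)) ≡.refl) (∙-congˡ (sym eq)))
    coset (x ∷ X) (suc (suc i) , h , eq) with coset X (i , h , eq)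
    ... | centre h p  = centre h p
    ... | plus i h p  = plus (suc i) h p
    ... | minus i h p = minus (suc i) h p

    module _ {l} (size-K : size K ≡ suc (l * 2) * size H) where
      private
        System : ℕ → Set (c ⊔ ℓ)
        System i = Σ (Vec Carrier i) λ X → (∀ j → representatives X j ∈ K) × Distinct (representatives X)

        uncovered? : ∀ {i} (X : Vec Carrier i) → (∀ k → Covered (representatives X) (embed K k)) ⊎
                     ∃ λ k → ¬ Covered (representatives X) (embed K k)
        uncovered? X with Fin.any? (λ k → ¬? (covered? (representatives X) (embed K k)))
        ... | yes outside = inj₂ outside
        ... | no  none    = inj₁ λ k → decidable-stable (covered? _ (embed K k)) (λ ¬c → none (k , ¬c))

        -- The choice is greedy. Fewer than l pairs cannot cover K, by counting, so some x in K is
        -- uncovered. Then -x is uncovered by symmetry, and x and -x are not congruent, because 2x ∈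
        -- H would put x in H, the coset of 0.
        system : ∀ i → i ≤ l → System i
        system zero    _   = [] , (λ _ → ∈-ε K) , λ { 0F 0F _ → ≡.refl }
        system (suc i) i<l with system i (ℕ.<⇒≤ i<l)
        ... | X , X∈K , distinct with uncovered? X
        ...   | inj₁ covering = contradiction (covering⇒≥ (representatives X) covering) (ℕ.<⇒≱
          (ℕ.<-≤-trans (ℕ.*-monoˡ-< (size H) ⦃ ℕ.>-nonZero (size-positive H) ⦄ (s≤s (ℕ.*-monoˡ-< 2 i<l)))
                       (ℕ.≤-reflexive (≡.sym size-K))))
        ...   | inj₂ (k , x∉X) = x ∷ X
          , (λ { 0F → embed-∈ K k ; 1F → ∈-⁻¹ K (embed-∈ K k) ; (suc (suc j)) → X∈K j })
          , Distinct-∷ x∉x⁻¹∷X (Distinct-∷ (λ p → x∉X (uninvert (covered-⁻¹ X p))) distinct)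
          where
          x = embed K k
          uninvert : Covered (representatives X) (x ⁻¹ ⁻¹) → Covered (representatives X) x
          uninvert (j , p) = j , ∈-resp H (∙-congʳ (⁻¹-involutive x)) p
          x∉x⁻¹∷X : ¬ Covered (x ⁻¹ Vector.∷ representatives X) x
          x∉x⁻¹∷X (0F , p) = x∉X (covered-H X (halve (∈-resp H (∙-congˡ (⁻¹-involutive x)) p)))
          x∉x⁻¹∷X (suc j , p) = x∉X (j , p)

      symmetric-transversal : Σ (Vec Carrier l) λ X → ∀ {g} → g ∈ K → Coset H X g
      symmetric-transversal with system l ℕ.≤-refl
      ... | X , X∈K , distinct with uncovered? X
      ...   | inj₁ covering = X , λ { {g} (k , eq) → coset X (resp eq (covering k)) }
        where
        resp : ∀ {g h} → g ≈ h → Covered (representatives X) g → Covered (representatives X) h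
        resp eq (i , p) = i , ∈-resp H (∙-congʳ eq) p
      -- An uncovered element of K would give 2l + 2 disjoint cosets, while K has room for 2l + 1.
      ...   | inj₂ (k , x∉X) = contradiction
        (distinct⇒≤ (embed K k Vector.∷ representatives X) (Distinct-∷ x∉X distinct)
          (λ { 0F → embed-∈ K k ; (suc j) → X∈K j }))
        (ℕ.<⇒≱ (ℕ.≤-<-trans (ℕ.≤-reflexive size-K)
          (ℕ.*-monoˡ-< (size H) ⦃ ℕ.>-nonZero (size-positive H) ⦄ (ℕ.n<1+n (suc (l * 2))))))

-- Necessity of two involutions

module Necessity {c ℓ : Level} (Γ : AbelianGroup c ℓ) {N : ℕ} (order : HasOrder Γ N) where
  open AbelianGroup Γ
  open import Relation.Binary.Reasoning.Setoid setoid
  open AbelianGroupSolver Γ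
  open FiniteAbelianGroup Γ order
  open Sums Γ

  involution? : ∀ x → Dec (IsInvolution Γ x)
  involution? x = ¬? (x ≟ ε) ×-dec (x ∙ x ≟ ε)

  exists-involution : 2 ∣ N → ∃ (IsInvolution Γ)
  exists-involution 2∣N with cauchy (indexed trivial) prime[2] (≡.subst (2 ∣_) N≡ 2∣N)
    where
    N≡ : N ≡ index (indexed trivial)
    N≡ = ≡.trans (≡.sym (index*size (indexed trivial))) (ℕ.*-identityʳ _)
  ... | g , g∉ , (_ , ε≈2g) = g , (λ g≈ε → g∉ (0F , sym g≈ε)) ,
        trans (∙-congˡ (sym (identityʳ g))) (sym ε≈2g)

  order·g≈ε : ∀ g → N · g ≈ ε
  order·g≈ε g = trans
    (×-congˡ {g} (≡.trans (≡.sym (index*size (indexed trivial))) (ℕ.*-identityʳ (index (indexed trivial)))))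
    (sym (proj₂ (annihilates (indexed trivial) g)))

  other-involution? : ∀ ι → (∀ {x} → IsInvolution Γ x → x ≈ ι) ⊎ ∃ λ x → IsInvolution Γ x × ¬ x ≈ ι
  other-involution? ι with search (λ { g≈h ((g≉ε , gg≈ε) , g≉ι) →
                                       ((λ h≈ε → g≉ε (trans g≈h h≈ε)) , trans (∙-cong (sym g≈h) (sym g≈h)) gg≈ε) ,
                                       (λ h≈ι → g≉ι (trans g≈h h≈ι)) })
                                  (λ x → involution? x ×-dec ¬? (x ≟ ι))
  ... | yes other = inj₂ other
  ... | no  none  = inj₁ λ {x} x-involution → decidable-stable (x ≟ ι) λ x≉ι → none (x , x-involution , x≉ι)

  module _ {a b c′} (M : MRS Γ a b c′) where
    open MRS M
    private
      cell : Fin c′ × Fin (b * a) → Carrier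
      -- Listing an array column by column makes its total a sum of column sums, which involves only
      -- δ.
      cell (k , x) = uncurry (λ j i → A k i j) (remQuot {b} a x)

      cells : Fin (c′ * (b * a)) → Carrier
      cells = cell ∘ remQuot (b * a)

      cell-injective : ∀ p q → cell p ≈ cell q → p ≡ q
      cell-injective (k , x) (k′ , y) eq with injective _ _ _ _ _ _ eq
      ... | ≡.refl , i≡ , j≡ = ≡.cong (k ,_) (≡.trans (≡.sym (Fin.combine-remQuot {b} a x))
              (≡.trans (≡.cong₂ combine j≡ i≡) (Fin.combine-remQuot {b} a y)))

      cells-injective : ∀ {x y} → cells x ≈ cells y → x ≡ y
      cells-injective {x} {y} eq = ≡.trans (≡.sym (Fin.combine-remQuot {c′} (b * a) x))
        (≡.trans (≡.cong (uncurry combine) (cell-injective (remQuot (b * a) x) (remQuot (b * a) y) eq))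
          (Fin.combine-remQuot {c′} (b * a) y))

      cells-surjective : ∀ g → ∃ λ x → cells x ≈ g
      cells-surjective g with surjective g
      ... | k , i , j , eq = combine k (combine j i) , trans (reflexive
        (≡.trans (≡.cong cell (Fin.remQuot-combine k (combine j i)))
                 (≡.cong (uncurry (λ j i → A k i j)) (Fin.remQuot-combine j i)))) eq

      sum-cells : sumΓ Γ (c′ * (b * a)) cells ≈ (c′ * b) · δ
      sum-cells = begin
        sumΓ Γ (c′ * (b * a)) cells                          ≈⟨ sumΓ-remQuot c′ (b * a) cell ⟩
        sumΓ Γ c′ (λ k → sumΓ Γ (b * a) (λ x → cell (k , x))) ≈⟨ sumΓ-cong c′ array ⟩
        sumΓ Γ c′ (λ _ → b · δ)                              ≈⟨ sumΓ-const c′ (b · δ) ⟩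
        c′ · (b · δ)                                         ≈⟨ ×-assocˡ δ c′ b ⟩
        (c′ * b) · δ                                         ∎
        where
        array : ∀ k → sumΓ Γ (b * a) (λ x → cell (k , x)) ≈ b · δ
        array k = trans (sumΓ-remQuot b a (uncurry (λ j i → A k i j)))
                        (trans (sumΓ-cong b (colSum k)) (sumΓ-const b δ))

    -- A unique involution ι would be the sum of all elements, which is `(c′ * b) · δ`. Multiplying
    -- by the odd number `a` fixes ι but turns the other side into N·δ = 0.
    MRS⇒involutions : 2 ∣ N → ∀ {l} → a ≡ 2 * l + 1 → N ≡ a * (c′ * b) → MoreThanOneInvolution Γ
    MRS⇒involutions 2∣N {l} a≡ N≡ with exists-involution 2∣N
    ... | ι , ι≉ε , ιι≈ε with other-involution? ι
    ...   | inj₂ (x , x-involution , x≉ι) = x , ι , x-involution , (ι≉ε , ιι≈ε) , x≉ι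
    ...   | inj₁ unique = contradiction ι≈ε ι≉ε
      where
      ι≈cδ : ι ≈ (c′ * b) · δ
      ι≈cδ = trans (sym (sum-all≈involution (ι≉ε , ιι≈ε) unique (_≟ ε) cells cells-injective cells-surjective)) sum-cells
      odd-multiple : ∀ l → (2 * l + 1) · ι ≈ ι
      odd-multiple zero    = identityʳ ι
      odd-multiple (suc l) = begin
        (2 * suc l + 1) · ι        ≡⟨ ≡.cong (_· ι) (peel l) ⟩
        ι ∙ (ι ∙ (2 * l + 1) · ι)  ≈⟨ assoc _ _ _ ⟨
        ι ∙ ι ∙ (2 * l + 1) · ι    ≈⟨ ∙-congʳ ιι≈ε ⟩
        ε ∙ (2 * l + 1) · ι        ≈⟨ identityˡ _ ⟩
        (2 * l + 1) · ι            ≈⟨ odd-multiple l ⟩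
        ι                          ∎
        where
        peel : ∀ l → 2 * suc l + 1 ≡ 2 + (2 * l + 1)
        peel = solve-∀
      ι≈ε : ι ≈ ε
      ι≈ε = begin
        ι                    ≈⟨ odd-multiple l ⟨
        (2 * l + 1) · ι      ≡⟨ ≡.cong (_· ι) a≡ ⟨
        a · ι                ≈⟨ ×-congʳ a ι≈cδ ⟩
        a · ((c′ * b) · δ)   ≈⟨ ×-assocˡ δ a (c′ * b) ⟩
        (a * (c′ * b)) · δ   ≡⟨ ≡.cong (_· δ) N≡ ⟨
        N · δ                ≈⟨ order·g≈ε δ ⟩
        ε                    ∎

-- The group of order 16

-- In the columns (b , s) of an array, with b < 4 and s < 2, row r < 3 holds the entry of kind
-- kind-at b r, where α, β, γ have kinds 0, 1, 2. Every row contains as many βs as γs, so the offsets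
-- ±x₀ cancel along the row.
kind-at : Fin 4 → Fin 3 → Fin 3
kind-at 0F = lookup (2F ∷ 0F ∷ 1F ∷ [])
kind-at 1F = lookup (0F ∷ 2F ∷ 1F ∷ [])
kind-at 2F = lookup (1F ∷ 0F ∷ 2F ∷ [])
kind-at 3F = lookup (0F ∷ 1F ∷ 2F ∷ [])

row-of : Fin 4 → Fin 3 → Fin 3
row-of 0F = lookup (1F ∷ 2F ∷ 0F ∷ [])
row-of 1F = lookup (0F ∷ 2F ∷ 1F ∷ [])
row-of 2F = lookup (1F ∷ 0F ∷ 2F ∷ [])
row-of 3F = lookup (0F ∷ 1F ∷ 2F ∷ [])

kind-at-of : ∀ b κ → kind-at b (row-of b κ) ≡ κ
kind-at-of 0F 0F = ≡.refl
kind-at-of 0F 1F = ≡.refl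
kind-at-of 0F 2F = ≡.refl
kind-at-of 1F 0F = ≡.refl
kind-at-of 1F 1F = ≡.refl
kind-at-of 1F 2F = ≡.refl
kind-at-of 2F 0F = ≡.refl
kind-at-of 2F 1F = ≡.refl
kind-at-of 2F 2F = ≡.refl
kind-at-of 3F 0F = ≡.refl
kind-at-of 3F 1F = ≡.refl
kind-at-of 3F 2F = ≡.refl

-- The signs with which xᵢ + α, for i ≥ 1, starts in the four pairs of columns. They are balanced,
-- so xᵢ cancels along each row.
sign : Fin 4 → Fin 2
sign = lookup (0F ∷ 0F ∷ 1F ∷ 1F ∷ [])

-- The index 8d + 4c + 2b + a stands for ax + by + cz + dw, where 2x = 2y = 0, and 2z and 2w are the
-- elements of indices u and v.
law : Fin 4 → Fin 8 → Fin 16 → Fin 16 → Fin 16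
law u v = extendAdd 1 (extendAdd 1 (extendAdd 1 (extendAdd 1 {1} (λ _ _ → 0F) 0F) 0F) u) v

-- Found by computer search. In the hexadecimal entry αβγ the three digits are the elements of kinds
-- 0, 1, 2 in a column; entry 8t + 2b + s is column (b , s) of array t.
table : Fin 4 → Fin 8 → Vec ℕ 16
table 0F 0F = 0x0cc ∷ 0xa5f ∷ 0xc7b ∷ 0x312 ∷ 0x220 ∷ 0x6f9 ∷ 0x5d8 ∷ 0x4ae ∷ 0xeb5 ∷ 0x101 ∷ 0xd94 ∷ 0x743 ∷ 0xb6d ∷ 0x8e6 ∷ 0xf87 ∷ 0x93a ∷ []
table 0F 1F = 0x7ca ∷ 0xe1e ∷ 0x4af ∷ 0x176 ∷ 0xf3d ∷ 0x660 ∷ 0xd0c ∷ 0x991 ∷ 0x28b ∷ 0x347 ∷ 0x8b2 ∷ 0x5d9 ∷ 0xb28 ∷ 0xaf4 ∷ 0x055 ∷ 0xce3 ∷ []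
table 0F 2F = 0x6d9 ∷ 0x288 ∷ 0x87d ∷ 0x7be ∷ 0x563 ∷ 0xca4 ∷ 0x3ef ∷ 0x101 ∷ 0x9c7 ∷ 0xf1c ∷ 0x022 ∷ 0xd5a ∷ 0xa3b ∷ 0xbf6 ∷ 0x440 ∷ 0xe95 ∷ []
table 0F 3F = 0x4f8 ∷ 0xe85 ∷ 0xf2e ∷ 0x2cd ∷ 0x563 ∷ 0xd97 ∷ 0x642 ∷ 0x95f ∷ 0xcb4 ∷ 0x011 ∷ 0x3aa ∷ 0x8d6 ∷ 0x770 ∷ 0xa09 ∷ 0xb3b ∷ 0x1ec ∷ []
table 0F 4F = 0x213 ∷ 0x985 ∷ 0x6df ∷ 0x80c ∷ 0xe4e ∷ 0xde7 ∷ 0x330 ∷ 0x5cd ∷ 0x0fb ∷ 0x462 ∷ 0xb5a ∷ 0xaa4 ∷ 0xc91 ∷ 0x7b8 ∷ 0x176 ∷ 0xf29 ∷ []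
table 0F 5F = 0x7df ∷ 0x9b7 ∷ 0xac3 ∷ 0x4fe ∷ 0x312 ∷ 0xd91 ∷ 0xb86 ∷ 0x550 ∷ 0x80d ∷ 0x145 ∷ 0x0eb ∷ 0xc3a ∷ 0xf28 ∷ 0xe7c ∷ 0x6a9 ∷ 0x264 ∷ []
table 0F 6F = 0xf90 ∷ 0xa59 ∷ 0xb6b ∷ 0x9d2 ∷ 0x6ee ∷ 0x734 ∷ 0x3fa ∷ 0x527 ∷ 0xe08 ∷ 0x145 ∷ 0x28c ∷ 0xcc6 ∷ 0x81f ∷ 0x0bd ∷ 0xda1 ∷ 0x473 ∷ []
table 0F 7F = 0x0cb ∷ 0x617 ∷ 0x330 ∷ 0xde4 ∷ 0x451 ∷ 0x29c ∷ 0x145 ∷ 0xf08 ∷ 0x986 ∷ 0xe7e ∷ 0x5b9 ∷ 0xa2f ∷ 0x7aa ∷ 0x8d2 ∷ 0xc6d ∷ 0xbf3 ∷ []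
table 1F 0F = 0xf2c ∷ 0x2a8 ∷ 0xac7 ∷ 0x551 ∷ 0xd1d ∷ 0xc85 ∷ 0x033 ∷ 0x39a ∷ 0x8f6 ∷ 0x96e ∷ 0x7db ∷ 0x472 ∷ 0x6e9 ∷ 0xbb0 ∷ 0x144 ∷ 0xe0f ∷ []
table 1F 1F = 0x274 ∷ 0x8b2 ∷ 0x7f8 ∷ 0x93b ∷ 0xde3 ∷ 0x3cf ∷ 0x1dc ∷ 0xba0 ∷ 0x526 ∷ 0xf87 ∷ 0x045 ∷ 0xe0e ∷ 0xa1a ∷ 0x661 ∷ 0x49d ∷ 0xc59 ∷ []
table 1F 2F = 0x573 ∷ 0x6eb ∷ 0xbd5 ∷ 0x3ff ∷ 0xf48 ∷ 0x8b1 ∷ 0xea7 ∷ 0x054 ∷ 0xd2c ∷ 0x132 ∷ 0x2cd ∷ 0x49e ∷ 0xc69 ∷ 0x91a ∷ 0x706 ∷ 0xa80 ∷ []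
table 1F 3F = 0x155 ∷ 0x4ca ∷ 0x0fd ∷ 0xae6 ∷ 0xba2 ∷ 0x289 ∷ 0x303 ∷ 0x540 ∷ 0xc1f ∷ 0x634 ∷ 0xd78 ∷ 0x9b1 ∷ 0x79c ∷ 0xe2e ∷ 0x8d7 ∷ 0xf6b ∷ []
table 1F 4F = 0x18c ∷ 0xe7d ∷ 0xb97 ∷ 0xdf6 ∷ 0x2cb ∷ 0x321 ∷ 0x540 ∷ 0x8e3 ∷ 0xc09 ∷ 0x414 ∷ 0x735 ∷ 0x6b8 ∷ 0x96a ∷ 0xf5e ∷ 0xad2 ∷ 0x0af ∷ []
table 1F 5F = 0x607 ∷ 0xb5a ∷ 0xfa1 ∷ 0xc3b ∷ 0x045 ∷ 0x884 ∷ 0xd90 ∷ 0xa68 ∷ 0x9e3 ∷ 0x312 ∷ 0x7df ∷ 0x2f9 ∷ 0x526 ∷ 0x4cd ∷ 0x1be ∷ 0xe7c ∷ []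
table 1F 6F = 0x551 ∷ 0x7cd ∷ 0xb84 ∷ 0xe3a ∷ 0x247 ∷ 0x4a9 ∷ 0x022 ∷ 0x6ff ∷ 0xad0 ∷ 0xd1b ∷ 0xf7e ∷ 0x9b5 ∷ 0x1e8 ∷ 0x303 ∷ 0x896 ∷ 0xc6c ∷ []
table 1F 7F = 0x6ef ∷ 0xc0a ∷ 0x91e ∷ 0x29d ∷ 0x346 ∷ 0x4a8 ∷ 0xd6c ∷ 0xb85 ∷ 0x771 ∷ 0x85b ∷ 0x0f9 ∷ 0xed4 ∷ 0x537 ∷ 0x123 ∷ 0xfb2 ∷ 0xac0 ∷ []
table 2F 0F = 0x453 ∷ 0x6ea ∷ 0x525 ∷ 0x87d ∷ 0x088 ∷ 0xed1 ∷ 0xaf7 ∷ 0x990 ∷ 0xc0e ∷ 0x312 ∷ 0xdb4 ∷ 0xf49 ∷ 0xb6f ∷ 0x2cc ∷ 0x736 ∷ 0x1ab ∷ []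
table 2F 1F = 0x705 ∷ 0x188 ∷ 0x2fe ∷ 0x424 ∷ 0xa6f ∷ 0x8d6 ∷ 0xd97 ∷ 0xf7b ∷ 0x9a2 ∷ 0x0ba ∷ 0x6c9 ∷ 0xce1 ∷ 0x543 ∷ 0x330 ∷ 0xe1c ∷ 0xb5d ∷ []
table 2F 2F = 0xc7b ∷ 0x345 ∷ 0xde3 ∷ 0xe68 ∷ 0x5fa ∷ 0x839 ∷ 0x1cd ∷ 0x057 ∷ 0xa91 ∷ 0x220 ∷ 0xf1e ∷ 0x9d4 ∷ 0x406 ∷ 0x78f ∷ 0xbb2 ∷ 0x6ac ∷ []
table 2F 3F = 0xf5b ∷ 0xa18 ∷ 0xdb7 ∷ 0x8d4 ∷ 0x48d ∷ 0xc49 ∷ 0x736 ∷ 0xef0 ∷ 0x165 ∷ 0x2cf ∷ 0x022 ∷ 0x3ec ∷ 0x90a ∷ 0xb91 ∷ 0x673 ∷ 0x5ae ∷ []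
table 2F 4F = 0x996 ∷ 0xb7a ∷ 0x5fe ∷ 0x303 ∷ 0x81f ∷ 0xfc7 ∷ 0x1bc ∷ 0x255 ∷ 0x662 ∷ 0xa84 ∷ 0x4dd ∷ 0xe3b ∷ 0x741 ∷ 0xd29 ∷ 0xca0 ∷ 0x0e8 ∷ []
table 2F 5F = 0x220 ∷ 0x39d ∷ 0xcd4 ∷ 0xbf3 ∷ 0xaa7 ∷ 0xd1b ∷ 0x741 ∷ 0x406 ∷ 0xf6c ∷ 0x878 ∷ 0x552 ∷ 0x6cf ∷ 0xe3a ∷ 0x0e9 ∷ 0x9b5 ∷ 0x18e ∷ []
table 2F 6F = 0xaf1 ∷ 0x83f ∷ 0x303 ∷ 0x525 ∷ 0x417 ∷ 0xb4b ∷ 0x97a ∷ 0x2e8 ∷ 0xea0 ∷ 0x064 ∷ 0xcc6 ∷ 0x6b9 ∷ 0xd5e ∷ 0xf92 ∷ 0x7dc ∷ 0x18d ∷ []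
table 2F 7F = 0x6cd ∷ 0xd19 ∷ 0x101 ∷ 0x5bb ∷ 0x93f ∷ 0x220 ∷ 0xbd3 ∷ 0xa5a ∷ 0x885 ∷ 0xf6e ∷ 0x442 ∷ 0xcf4 ∷ 0xee7 ∷ 0x09c ∷ 0x7a8 ∷ 0x376 ∷ []
table 3F 0F = 0x3b8 ∷ 0x5ac ∷ 0x636 ∷ 0xc1e ∷ 0x751 ∷ 0xb83 ∷ 0x1fd ∷ 0x2ef ∷ 0xf95 ∷ 0x470 ∷ 0xdc2 ∷ 0xad4 ∷ 0x909 ∷ 0x047 ∷ 0xe6b ∷ 0x82a ∷ []
table 3F 1F = 0xfd0 ∷ 0xee2 ∷ 0x377 ∷ 0x164 ∷ 0x416 ∷ 0xda5 ∷ 0xc3d ∷ 0x5bc ∷ 0xa29 ∷ 0x908 ∷ 0x7fa ∷ 0x641 ∷ 0x85f ∷ 0x0ce ∷ 0xb93 ∷ 0x28b ∷ []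
table 3F 2F = 0xba3 ∷ 0x6f8 ∷ 0x740 ∷ 0xae5 ∷ 0x90b ∷ 0x85c ∷ 0x416 ∷ 0x5bf ∷ 0xc3e ∷ 0xfc2 ∷ 0xe2d ∷ 0xdd1 ∷ 0x299 ∷ 0x377 ∷ 0x164 ∷ 0x08a ∷ []
table 3F 3F = 0x0a9 ∷ 0x5eb ∷ 0xac6 ∷ 0xb80 ∷ 0xe4a ∷ 0xf2d ∷ 0xcb7 ∷ 0x993 ∷ 0x461 ∷ 0x254 ∷ 0x605 ∷ 0x7f8 ∷ 0xd1c ∷ 0x87f ∷ 0x132 ∷ 0x3de ∷ []
table 3F 4F = 0x18e ∷ 0x968 ∷ 0x39d ∷ 0xa49 ∷ 0xc1a ∷ 0x553 ∷ 0x0cb ∷ 0xbd1 ∷ 0xfe5 ∷ 0x704 ∷ 0x470 ∷ 0xeb2 ∷ 0x2af ∷ 0xdf6 ∷ 0x83c ∷ 0x627 ∷ []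
table 3F 5F = 0x056 ∷ 0xc4d ∷ 0x5b8 ∷ 0xd6e ∷ 0x2fb ∷ 0xa3f ∷ 0x8c2 ∷ 0x789 ∷ 0xbe3 ∷ 0xe2a ∷ 0x101 ∷ 0x377 ∷ 0xf90 ∷ 0x4dc ∷ 0x9a5 ∷ 0x614 ∷ []
table 3F 6F = 0xac3 ∷ 0x91d ∷ 0x605 ∷ 0x1ea ∷ 0xc81 ∷ 0x4df ∷ 0x8a7 ∷ 0x7b9 ∷ 0xe92 ∷ 0x344 ∷ 0xb2c ∷ 0x2f8 ∷ 0x056 ∷ 0xf7e ∷ 0xd3b ∷ 0x560 ∷ []
table 3F 7F = 0x175 ∷ 0x8e2 ∷ 0xfc4 ∷ 0x69b ∷ 0xc2a ∷ 0xda3 ∷ 0x751 ∷ 0x517 ∷ 0x4de ∷ 0xef6 ∷ 0x08c ∷ 0xa68 ∷ 0x949 ∷ 0xb0f ∷ 0x330 ∷ 0x2bd ∷ []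

digit : Fin 3 → ℕ → Fin 16
digit 0F n = (n / 256) mod 16
digit 1F n = (n / 16) mod 16
digit 2F n = n mod 16

base : Fin 4 → Fin 8 → Fin 2 → Fin 4 × Fin 2 → Fin 3 → Fin 16
base u v t (b , s) κ = digit κ (lookup (table u v) (combine t (combine b s)))

total : ∀ {k} → (Fin k → Fin k → Fin k) → Fin k → ∀ n → (Fin n → Fin k) → Fin k
total add unit zero    f = unit
total add unit (suc n) f = add (f zero) (total add unit n (f ∘ suc))

-- The third condition is the vanishing of the signed sum of the αs, written without negatives: the
-- columns of positive sign are the first four, those of negative sign the last four.
IsBase : (Fin 16 → Fin 16 → Fin 16) → (Fin 2 → Fin 4 × Fin 2 → Fin 3 → Fin 16) → Set
IsBase _+_ W =
  (∀ t b s → let w = W t (b , s) in w 0F + (w 1F + w 2F) ≡ 0F) ×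
  (∀ t r → total _+_ 0F 8 ((λ x → W t x (kind-at (proj₁ x) r)) ∘ remQuot 2) ≡ 0F) ×
  (∀ t → total _+_ 0F 4 ((λ (b , s) → W t (b , s) 0F) ∘ remQuot {4} 2 ∘ (Fin._↑ˡ 4)) ≡
         total _+_ 0F 4 ((λ (b , s) → W t (b , s) 0F) ∘ remQuot {4} 2 ∘ (4 Fin.↑ʳ_))) ×
  (∀ κ p → ∃ λ t → ∃ λ b → ∃ λ s → W t (b , s) κ ≡ p)

isBase? : ∀ add W → Dec (IsBase add W)
isBase? _+_ W =
  (Fin.all? λ t → Fin.all? λ b → Fin.all? λ s → _ Fin.≟ _) ×-dec
  (Fin.all? λ t → Fin.all? λ r → _ Fin.≟ _) ×-dec
  (Fin.all? λ t → _ Fin.≟ _) ×-dec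
  (Fin.all? λ κ → Fin.all? λ p → Fin.any? λ t → Fin.any? λ b → Fin.any? λ s → _ Fin.≟ _)

base-isBase? : Dec (∀ u v → IsBase (law u v) (base u v))
base-isBase? = Fin.all? λ u → Fin.all? λ v → isBase? (law u v) (base u v)

-- Proved by evaluating the decision procedure on all 32 tables.
base-isBase : ∀ u v → IsBase (law u v) (base u v)
base-isBase = toWitness {a? = base-isBase?} tt

-- Construction of the rectangles

module Sufficiency {c ℓ : Level} (Γ : AbelianGroup c ℓ) {N : ℕ} (order : HasOrder Γ N) where
  open AbelianGroup Γ
  open import Algebra.Properties.AbelianGroup Γ using (⁻¹-∙-comm)
  open import Algebra.Properties.Group group using (⁻¹-involutive; ε⁻¹≈ε)
  open import Relation.Binary.Reasoning.Setoid setoid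
  open AbelianGroupSolver Γ
  open FiniteAbelianGroup Γ order
  open Sums Γ

  flip : Fin 2 → Carrier → Carrier
  flip 0F x = x
  flip 1F x = x ⁻¹

  flip-cong : ∀ s {x y} → x ≈ y → flip s x ≈ flip s y
  flip-cong 0F eq = eq
  flip-cong 1F eq = ⁻¹-cong eq

  flip-∙ : ∀ s x y → flip s (x ∙ y) ≈ flip s x ∙ flip s y
  flip-∙ 0F x y = refl
  flip-∙ 1F x y = sym (⁻¹-∙-comm x y)

  flip-ε : ∀ s → flip s ε ≈ ε
  flip-ε 0F = refl
  flip-ε 1F = ε⁻¹≈ε

  flip-flip : ∀ s x → flip s (flip s x) ≈ x
  flip-flip 0F x = refl
  flip-flip 1F x = ⁻¹-involutive x

  flip-opposite : ∀ s x → flip (Fin.opposite s) (flip s x) ≈ x ⁻¹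
  flip-opposite 0F x = refl
  flip-opposite 1F x = refl

  sumΓ-flip : ∀ s n (f : Fin n → Carrier) → sumΓ Γ n (flip s ∘ f) ≈ flip s (sumΓ Γ n f)
  sumΓ-flip s zero    f = sym (flip-ε s)
  sumΓ-flip s (suc n) f = trans (∙-congˡ (sumΓ-flip s n (f ∘ suc))) (sym (flip-∙ s _ _))

  -- value k (b , s) lists the triple (α, β, γ) of column (b , s) in array k.
  record Columns (H : Subgroup) (n : ℕ) : Set (c ⊔ ℓ) where
    field
      value      : Fin n → Fin 4 × Fin 2 → Fin 3 → Carrier
      column-sum : ∀ k x → value k x 0F ∙ (value k x 1F ∙ value k x 2F) ≈ ε
      row-sum    : ∀ k r → sumΓ Γ 8 ((λ x → value k x (kind-at (proj₁ x) r)) ∘ remQuot 2) ≈ ε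
      signed-sum : ∀ k → sumΓ Γ 8 ((λ x → flip (sign (proj₁ x)) (value k x 0F)) ∘ remQuot 2) ≈ ε
      covers     : ∀ κ h → ∃ λ k → ∃ λ x → value k x κ ≈ embed H h
  open Columns public

  covers-∈ : ∀ {H n} (V : Columns H n) κ {g} → g ∈ H → ∃ λ k → ∃ λ x → value V k x κ ≈ g
  covers-∈ V κ (h , eq) with covers V κ h
  ... | k , x , eq′ = k , x , trans eq′ eq

  -- There are as many cells as group elements, so a filling that meets every element meets each
  -- exactly once. The construction therefore has to establish only that Γ is covered and that all
  -- lines sum to 0.
  surjective⇒MRS : ∀ {a b c′} (A : Fin c′ → Fin a → Fin b → Carrier) → c′ * (a * b) ≡ N →
                   (∀ g → ∃ λ k → ∃ λ i → ∃ λ j → A k i j ≈ g) →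
                   (∀ k i → sumΓ Γ b (A k i) ≈ ε) → (∀ k j → sumΓ Γ a (λ i → A k i j) ≈ ε) → MRS Γ a b c′
  surjective⇒MRS {a} {b} {c′} A size≡N onto row-sums column-sums = record
    { A          = A
    ; injective  = λ k i j k′ i′ j′ eq → cell-injective k i j k′ i′ j′
                     (surjective⇒injective size≡N code code-surjective
                       (≡.trans (code-combine k i j) (≡.trans (indexOf-cong eq) (≡.sym (code-combine k′ i′ j′)))))
    ; surjective = onto
    ; ω          = ε
    ; δ          = ε
    ; rowSum     = row-sums
    ; colSum     = column-sums
    }
    where
    cell : Fin c′ × Fin (a * b) → Carrier
    cell (k , x) = uncurry (A k) (remQuot b x)
    code : Fin (c′ * (a * b)) → Fin N
    code = indexOf ∘ cell ∘ remQuot (a * b)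
    code-combine : ∀ k i j → code (combine k (combine i j)) ≡ indexOf (A k i j)
    code-combine k i j = ≡.cong indexOf (≡.trans (≡.cong cell (Fin.remQuot-combine k (combine i j)))
                                                 (≡.cong (uncurry (A k)) (Fin.remQuot-combine i j)))
    code-surjective : ∀ y → ∃ λ x → code x ≡ y
    code-surjective y with onto (element y)
    ... | k , i , j , eq = combine k (combine i j) ,
          ≡.trans (code-combine k i j) (≡.trans (indexOf-cong eq) (indexOf-element y))
    cell-injective : ∀ k i j k′ i′ j′ → combine k (combine i j) ≡ combine k′ (combine i′ j′) →
                     k ≡ k′ × i ≡ i′ × j ≡ j′
    cell-injective k i j k′ i′ j′ eq with Fin.combine-injective k (combine i j) k′ (combine i′ j′) eq
    ... | k≡k′ , eq′ = k≡k′ , Fin.combine-injective i j i′ j′ eq′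

  -- Rectangles from the columns over H

  module Assemble {H : Subgroup} {n l : ℕ} (V : Columns H n) (X : Vec Carrier (suc l))
                  (cosets : ∀ g → Coset H X g) where
    Row : Set
    Row = Fin 3 ⊎ (Fin l × Fin 2)

    offset : Fin 3 → Carrier
    offset 0F = ε
    offset 1F = lookup X 0F
    offset 2F = lookup X 0F ⁻¹

    cell : Fin n → Row → Fin 4 × Fin 2 → Carrier
    cell k (inj₁ r)       x@(b , _) = offset (kind-at b r) ∙ value V k x (kind-at b r)
    -- `t` separates the two rows of a pair, which are negatives of each other; `sign b` decides
    -- which of them holds the unnegated entry in this column.
    cell k (inj₂ (i , t)) x@(b , _) = flip t (flip (sign b) (lookup X (suc i) ∙ value V k x 0F))

    offset-sum : ∀ r → sumΓ Γ 8 ((λ x → offset (kind-at (proj₁ x) r)) ∘ remQuot 2) ≈ ε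
    offset-sum 0F = solve (lookup X 0F ∷ []) (⊝ var 0F ⊕ ⊝ var 0F ⊕ 𝟘 ⊕ 𝟘 ⊕ var 0F ⊕ var 0F ⊕ 𝟘 ⊕ 𝟘 ⊕ 𝟘) 𝟘 ≡.refl
    offset-sum 1F = solve (lookup X 0F ∷ []) (𝟘 ⊕ 𝟘 ⊕ ⊝ var 0F ⊕ ⊝ var 0F ⊕ 𝟘 ⊕ 𝟘 ⊕ var 0F ⊕ var 0F ⊕ 𝟘) 𝟘 ≡.refl
    offset-sum 2F = solve (lookup X 0F ∷ []) (var 0F ⊕ var 0F ⊕ var 0F ⊕ var 0F ⊕ ⊝ var 0F ⊕ ⊝ var 0F ⊕ ⊝ var 0F ⊕ ⊝ var 0F ⊕ 𝟘) 𝟘 ≡.refl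

    row-sums : ∀ k row → sumΓ Γ 8 (cell k row ∘ remQuot 2) ≈ ε
    row-sums k (inj₁ r) = trans
      (sumΓ-∙ 8 ((λ x → offset (kind-at (proj₁ x) r)) ∘ remQuot {4} 2)
                ((λ x → value V k x (kind-at (proj₁ x) r)) ∘ remQuot {4} 2))
      (trans (∙-cong (offset-sum r) (row-sum V k r)) (identityˡ ε))
    row-sums k (inj₂ (i , t)) = trans
      (sumΓ-flip t 8 ((λ x → flip (sign (proj₁ x)) (y ∙ value V k x 0F)) ∘ remQuot {4} 2))
      (trans (flip-cong t (begin
        sumΓ Γ 8 ((λ x → flip (sign (proj₁ x)) (y ∙ value V k x 0F)) ∘ remQuot {4} 2)
          ≈⟨ sumΓ-cong 8 (λ j → flip-∙ (sign (proj₁ (remQuot {4} 2 j))) y (value V k (remQuot {4} 2 j) 0F)) ⟩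
        sumΓ Γ 8 ((λ x → flip (sign (proj₁ x)) y ∙ flip (sign (proj₁ x)) (value V k x 0F)) ∘ remQuot {4} 2)
          ≈⟨ sumΓ-∙ 8 ((λ x → flip (sign (proj₁ x)) y) ∘ remQuot {4} 2)
                      ((λ x → flip (sign (proj₁ x)) (value V k x 0F)) ∘ remQuot {4} 2) ⟩
        sumΓ Γ 8 ((λ x → flip (sign (proj₁ x)) y) ∘ remQuot {4} 2) ∙
        sumΓ Γ 8 ((λ x → flip (sign (proj₁ x)) (value V k x 0F)) ∘ remQuot {4} 2)
          ≈⟨ ∙-cong (solve (y ∷ []) (var 0F ⊕ var 0F ⊕ var 0F ⊕ var 0F ⊕ ⊝ var 0F ⊕ ⊝ var 0F ⊕ ⊝ var 0F ⊕ ⊝ var 0F ⊕ 𝟘) 𝟘 ≡.refl)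
                    (signed-sum V k) ⟩
        ε ∙ ε ≈⟨ identityˡ ε ⟩
        ε ∎)) (flip-ε t))
      where y = lookup X (suc i)

    row : Fin (3 + l * 2) → Row
    row = Sum.map₂ (remQuot 2) ∘ splitAt 3

    index-of-row : Row → Fin (3 + l * 2)
    index-of-row = join 3 (l * 2) ∘ Sum.map₂ (uncurry combine)

    row-index-of-row : ∀ r → row (index-of-row r) ≡ r
    row-index-of-row (inj₁ 0F) = ≡.refl
    row-index-of-row (inj₁ 1F) = ≡.refl
    row-index-of-row (inj₁ 2F) = ≡.refl
    row-index-of-row (inj₂ (i , t)) = ≡.cong inj₂ (Fin.remQuot-combine i t)

    paired-rows-sum : ∀ k x → sumΓ Γ (l * 2) ((λ p → cell k (inj₂ p) x) ∘ remQuot {l} 2) ≈ ε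
    paired-rows-sum k x = trans (sumΓ-remQuot l 2 (λ p → cell k (inj₂ p) x))
      (trans (sumΓ-cong l (λ i → solve (cell k (inj₂ (i , 0F)) x ∷ []) (var 0F ⊕ ⊝ var 0F ⊕ 𝟘) 𝟘 ≡.refl))
        (sumΓ-ε l))

    -- The paired rows cancel two by two, and above them 0, x₀, -x₀ cancel in whatever order
    -- `kind-at` puts them, leaving α + β + γ.
    column-sums : ∀ k x → sumΓ Γ (3 + l * 2) (λ i → cell k (row i) x) ≈ ε
    column-sums k x@(b , s) = trans (∙-congˡ (∙-congˡ (∙-congˡ (paired-rows-sum k x)))) (trans (top b) (column-sum V k x))
      where
      v = value V k x
      variables = v 0F ∷ v 1F ∷ v 2F ∷ lookup X 0F ∷ []
      α β γ kinds : Expr 4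
      α = 𝟘 ⊕ var 0F
      β = var 3F ⊕ var 1F
      γ = ⊝ var 3F ⊕ var 2F
      kinds = var 0F ⊕ var 1F ⊕ var 2F
      entry : Fin 4 → Fin 3 → Carrier
      entry b r = offset (kind-at b r) ∙ v (kind-at b r)
      top : ∀ b → entry b 0F ∙ (entry b 1F ∙ (entry b 2F ∙ ε)) ≈ v 0F ∙ (v 1F ∙ v 2F)
      top 0F = solve variables (γ ⊕ α ⊕ β ⊕ 𝟘) kinds ≡.refl
      top 1F = solve variables (α ⊕ γ ⊕ β ⊕ 𝟘) kinds ≡.refl
      top 2F = solve variables (β ⊕ α ⊕ γ ⊕ 𝟘) kinds ≡.refl
      top 3F = solve variables (α ⊕ β ⊕ γ ⊕ 𝟘) kinds ≡.refl

    Occurs : Carrier → Set ℓ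
    Occurs g = ∃ λ k → ∃ λ r → ∃ λ x → cell k r x ≈ g

    occurs-top : ∀ κ {g h} → h ∈ H → g ≈ offset κ ∙ h → Occurs g
    occurs-top κ h∈H eq with covers-∈ V κ h∈H
    ... | k , x@(b , _) , eq′ = k , inj₁ (row-of b κ) , x , trans
      (reflexive (≡.cong (λ κ → offset κ ∙ value V k x κ) (kind-at-of b κ)))
      (trans (∙-congˡ eq′) (sym eq))

    -- For xᵢ + h with i ≥ 1, a column with α = h is taken, and the row of the pair where the two
    -- signs cancel. For -xᵢ + h, it is α = -h and the other row, which holds -(xᵢ - h).
    occurs : ∀ g → Occurs g
    occurs g with cosets g
    ... | centre h eq      = occurs-top 0F (embed-∈ H h) (trans eq (sym (identityˡ _)))
    ... | plus zero h eq   = occurs-top 1F (embed-∈ H h) eq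
    ... | minus zero h eq  = occurs-top 2F (embed-∈ H h) eq
    ... | plus (suc i) h eq with covers V 0F h
    ...   | k , x@(b , _) , eq′ = k , inj₂ (i , sign b) , x ,
            trans (flip-flip (sign b) _) (trans (∙-congˡ eq′) (sym eq))
    occurs g | minus (suc i) h eq with covers-∈ V 0F (∈-⁻¹ H (embed-∈ H h))
    ...   | k , x@(b , _) , eq′ = k , inj₂ (i , Fin.opposite (sign b)) , x ,
            trans (flip-opposite (sign b) _) (trans (⁻¹-cong (∙-congˡ eq′)) (trans
              (solve (lookup X (suc i) ∷ embed H h ∷ []) (⊝ (var 0F ⊕ ⊝ var 1F)) (⊝ var 0F ⊕ var 1F) ≡.refl)
              (sym eq)))

    magic-rectangles : n * ((3 + l * 2) * 8) ≡ N → MRS Γ (3 + l * 2) 8 n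
    magic-rectangles size≡N = surjective⇒MRS (λ k i j → cell k (row i) (remQuot 2 j)) size≡N onto
      (λ k i → row-sums k (row i)) (λ k j → column-sums k (remQuot 2 j))
      where
      onto : ∀ g → ∃ λ k → ∃ λ i → ∃ λ j → cell k (row i) (remQuot 2 j) ≈ g
      onto g with occurs g
      ... | k , r , (b , s) , eq = k , index-of-row r , combine b s , trans
        (reflexive (≡.cong₂ (cell k) (row-index-of-row r) (Fin.remQuot-combine b s))) eq

  -- Columns over a larger subgroup K from columns over P

  module Lift {P K : Subgroup} (V : Columns P 2) {h} (Y : Vec Carrier h)
              (cosets : ∀ {g} → g ∈ K → Coset P Y g)
              (q : ℕ) (annihilated : ∀ g → suc (q * 2) · g ∈ P) where

    translate : Fin 3 → Carrier → Carrier
    translate 0F y = y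
    translate 1F y = y
    translate 2F y = (y ∙ y) ⁻¹

    Label : Set
    Label = Fin 2 ⊎ (Fin h × (Fin 2 × Fin 2))

    label : Fin (2 + h * 4) → Label
    label = Sum.map₂ (map₂ (remQuot 2) ∘ remQuot 4) ∘ splitAt 2

    index-of-label : Label → Fin (2 + h * 4)
    index-of-label = join 2 (h * 4) ∘ Sum.map₂ (uncurry combine ∘ map₂ (uncurry combine))

    label-index-of-label : ∀ x → label (index-of-label x) ≡ x
    label-index-of-label (inj₁ 0F) = ≡.refl
    label-index-of-label (inj₁ 1F) = ≡.refl
    label-index-of-label (inj₂ (i , t , s)) = ≡.cong inj₂
      (≡.trans (≡.cong (map₂ (remQuot 2)) (Fin.remQuot-combine i (combine t s)))
               (≡.cong (i ,_) (Fin.remQuot-combine t s)))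

    -- Array `(i , t , s′)` takes from each pair of columns of base array `t` only the one of index
    -- `s′`, shifts it by the translates of yᵢ and sets its negative beside it. Letting `s′` vary
    -- uses all base columns.
    lifted : Label → Fin 4 × Fin 2 → Fin 3 → Carrier
    lifted (inj₁ t)            x       κ = value V t x κ
    lifted (inj₂ (i , t , s′)) (b , s) κ = flip s (value V t (b , s′) κ ∙ translate κ (lookup Y i))

    antisymmetric-sum : ∀ (f : Fin 4 × Fin 2 → Carrier) → (∀ b → f (b , 1F) ≈ f (b , 0F) ⁻¹) →
                        sumΓ Γ 8 (f ∘ remQuot 2) ≈ ε
    antisymmetric-sum f anti = trans (sumΓ-remQuot 4 2 f)
      (trans (sumΓ-cong 4 (λ b → trans (∙-congˡ (trans (identityʳ _) (anti b))) (inverseʳ _))) (sumΓ-ε 4))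

    -- Reduces covering K to covering P: these are the shapes that `lifted` gives to entries of kind
    -- κ, with `p` free in P.
    data Signed (κ : Fin 3) (g : Carrier) : Set (c ⊔ ℓ) where
      central : g ∈ P → Signed κ g
      signed  : ∀ s i {p} → p ∈ P → g ≈ flip s (p ∙ translate κ (lookup Y i)) → Signed κ g

    signed-translate : ∀ {κ g} → (∀ y → translate κ y ≈ y) → g ∈ K → Signed κ g
    signed-translate translate≈ g∈K with cosets g∈K
    ... | centre p eq  = central (p , sym eq)
    ... | plus i p eq  = signed 0F i (embed-∈ P p) (trans eq (trans (comm _ _) (∙-congˡ (sym (translate≈ _)))))
    ... | minus i p eq = signed 1F i (∈-⁻¹ P (embed-∈ P p)) (trans eq (trans
          (solve (lookup Y i ∷ embed P p ∷ []) (⊝ var 0F ⊕ var 1F) (⊝ (⊝ var 1F ⊕ var 0F)) ≡.refl)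
          (⁻¹-cong (∙-congˡ (sym (translate≈ _))))))

    -- Modulo P, multiplication by −2 is inverted by multiplication by q, since 2q + 1 annihilates.
    signed-double : ∀ {g} → g ∈ K → Signed 2F g
    signed-double {g} g∈K = go (cosets (∈-· K q g∈K))
      where
      m = suc (q * 2) · g
      g≈ : g ≈ m ∙ (q · g ∙ q · g) ⁻¹
      g≈ = begin
        g
          ≈⟨ solve (g ∷ q · g ∷ []) (var 0F) ((var 0F ⊕ 2 ⊛ var 1F) ⊕ ⊝ (var 1F ⊕ var 1F)) ≡.refl ⟩
        g ∙ 2 · (q · g) ∙ (q · g ∙ q · g) ⁻¹
          ≈⟨ ∙-congʳ (∙-congˡ (trans (×-assocˡ g 2 q) (×-congˡ (ℕ.*-comm 2 q)))) ⟩
        m ∙ (q · g ∙ q · g) ⁻¹ ∎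
      go : Coset P Y (q · g) → Signed 2F g
      go (centre p eq) = central (∈-resp P (sym (trans g≈ (∙-congˡ (⁻¹-cong (∙-cong eq eq)))))
        (∈-∙ P (annihilated g) (∈-⁻¹ P (∈-∙ P (embed-∈ P p) (embed-∈ P p)))))
      go (plus i p eq) = signed 0F i (∈-∙ P (annihilated g) (∈-⁻¹ P (∈-∙ P (embed-∈ P p) (embed-∈ P p))))
        (trans g≈ (trans (∙-congˡ (⁻¹-cong (∙-cong eq eq)))
          (solve (m ∷ lookup Y i ∷ embed P p ∷ [])
            (var 0F ⊕ ⊝ ((var 1F ⊕ var 2F) ⊕ (var 1F ⊕ var 2F)))
            ((var 0F ⊕ ⊝ (var 2F ⊕ var 2F)) ⊕ ⊝ (var 1F ⊕ var 1F)) ≡.refl)))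
      go (minus i p eq) = signed 1F i (∈-⁻¹ P (∈-∙ P (annihilated g) (∈-⁻¹ P (∈-∙ P (embed-∈ P p) (embed-∈ P p)))))
        (trans g≈ (trans (∙-congˡ (⁻¹-cong (∙-cong eq eq)))
          (solve (m ∷ lookup Y i ∷ embed P p ∷ [])
            (var 0F ⊕ ⊝ ((⊝ var 1F ⊕ var 2F) ⊕ (⊝ var 1F ⊕ var 2F)))
            (⊝ (⊝ (var 0F ⊕ ⊝ (var 2F ⊕ var 2F)) ⊕ ⊝ (var 1F ⊕ var 1F))) ≡.refl)))

    signed-form : ∀ κ {g} → g ∈ K → Signed κ g
    signed-form 0F = signed-translate (λ _ → refl)
    signed-form 1F = signed-translate (λ _ → refl)
    signed-form 2F = signed-double

    lifted-covers : ∀ κ {g} → g ∈ K → ∃ λ k → ∃ λ x → lifted k x κ ≈ g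
    lifted-covers κ g∈K with signed-form κ g∈K
    ... | central g∈P with covers-∈ V κ g∈P
    ...   | t , x , eq = inj₁ t , x , eq
    lifted-covers κ g∈K | signed s i p∈P eq with covers-∈ V κ p∈P
    ...   | t , (b , s′) , eq′ = inj₂ (i , t , s′) , (b , s) , trans (flip-cong s (∙-congʳ eq′)) (sym eq)

    columns : Columns K (2 + h * 4)
    columns = record
      { value      = lifted ∘ label
      ; column-sum = λ k → column (label k)
      ; row-sum    = λ k → row (label k)
      ; signed-sum = λ k → paired (label k)
      ; covers     = cover
      }
      where
      column : ∀ k x → lifted k x 0F ∙ (lifted k x 1F ∙ lifted k x 2F) ≈ ε
      column (inj₁ t) x = column-sum V t x
      column (inj₂ (i , t , s′)) (b , s) = begin
        flip s (v 0F ∙ y) ∙ (flip s (v 1F ∙ y) ∙ flip s (v 2F ∙ (y ∙ y) ⁻¹))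
          ≈⟨ trans (flip-∙ s _ _) (∙-congˡ (flip-∙ s _ _)) ⟨
        flip s (v 0F ∙ y ∙ (v 1F ∙ y ∙ (v 2F ∙ (y ∙ y) ⁻¹)))
          ≈⟨ flip-cong s (solve (v 0F ∷ v 1F ∷ v 2F ∷ y ∷ [])
               ((var 0F ⊕ var 3F) ⊕ (var 1F ⊕ var 3F) ⊕ (var 2F ⊕ ⊝ (var 3F ⊕ var 3F)))
               (var 0F ⊕ var 1F ⊕ var 2F) ≡.refl) ⟩
        flip s (v 0F ∙ (v 1F ∙ v 2F)) ≈⟨ flip-cong s (column-sum V t (b , s′)) ⟩
        flip s ε                      ≈⟨ flip-ε s ⟩
        ε                             ∎
        where
        v = value V t (b , s′)
        y = lookup Y i
      row : ∀ k r → sumΓ Γ 8 ((λ x → lifted k x (kind-at (proj₁ x) r)) ∘ remQuot 2) ≈ ε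
      row (inj₁ t) r = row-sum V t r
      row k@(inj₂ _) r = antisymmetric-sum (λ x → lifted k x (kind-at (proj₁ x) r)) (λ _ → refl)
      paired : ∀ k → sumΓ Γ 8 ((λ x → flip (sign (proj₁ x)) (lifted k x 0F)) ∘ remQuot 2) ≈ ε
      paired (inj₁ t) = signed-sum V t
      paired k@(inj₂ _) = antisymmetric-sum (λ x → flip (sign (proj₁ x)) (lifted k x 0F))
        (λ b → flip-⁻¹ (sign b) (lifted k (b , 0F) 0F))
        where
        flip-⁻¹ : ∀ s x → flip s (x ⁻¹) ≈ flip s x ⁻¹
        flip-⁻¹ 0F x = refl
        flip-⁻¹ 1F x = refl
      cover : ∀ κ j → ∃ λ k → ∃ λ x → lifted (label k) x κ ≈ embed K j
      cover κ j with lifted-covers κ (embed-∈ K j)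
      ... | k , x , eq = index-of-label k , x ,
            trans (reflexive (≡.cong (λ k → lifted k x κ) (label-index-of-label k))) eq

  -- Columns over P from the table

  module Base (P : Subgroup) (e : Fin 16 → Carrier) (e-0 : e 0F ≈ ε)
              (_+₁₆_ : Fin 16 → Fin 16 → Fin 16) (e-law : ∀ i j → e (i +₁₆ j) ≈ e i ∙ e j)
              (W : Fin 2 → Fin 4 × Fin 2 → Fin 3 → Fin 16) (W-isBase : IsBase _+₁₆_ W)
              (e-onto : ∀ h → ∃ λ i → e i ≈ embed P h) where
    private
      e-total : ∀ n f → e (total _+₁₆_ 0F n f) ≈ sumΓ Γ n (e ∘ f)
      e-total zero    f = e-0
      e-total (suc n) f = trans (e-law _ _) (∙-congˡ (e-total n (f ∘ suc)))

      column : ∀ t b s → e (W t (b , s) 0F) ∙ (e (W t (b , s) 1F) ∙ e (W t (b , s) 2F)) ≈ ε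
      column t b s = begin
        e (w 0F) ∙ (e (w 1F) ∙ e (w 2F))               ≈⟨ ∙-congˡ (e-law (w 1F) (w 2F)) ⟨
        e (w 0F) ∙ e (w 1F +₁₆ w 2F)           ≈⟨ e-law (w 0F) _ ⟨
        e (w 0F +₁₆ (w 1F +₁₆ w 2F))     ≡⟨ ≡.cong e (proj₁ W-isBase t b s) ⟩
        e 0F                                           ≈⟨ e-0 ⟩
        ε                                              ∎
        where w = W t (b , s)

      row : ∀ t r → sumΓ Γ 8 ((λ x → e (W t x (kind-at (proj₁ x) r))) ∘ remQuot 2) ≈ ε
      row t r = begin
        sumΓ Γ 8 (e ∘ f)              ≈⟨ e-total 8 f ⟨
        e (total _+₁₆_ 0F 8 f)    ≡⟨ ≡.cong e (proj₁ (proj₂ W-isBase) t r) ⟩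
        e 0F                          ≈⟨ e-0 ⟩
        ε                             ∎
        where
        f : Fin 8 → Fin 16
        f = (λ x → W t x (kind-at (proj₁ x) r)) ∘ remQuot {4} 2

      paired : ∀ t → sumΓ Γ 8 ((λ x → flip (sign (proj₁ x)) (e (W t x 0F))) ∘ remQuot 2) ≈ ε
      paired t = begin
        sumΓ Γ 8 ((λ x → flip (sign (proj₁ x)) (e (W t x 0F))) ∘ remQuot 2)
          ≈⟨ solve (Vec.tabulate f)
               (var 0F ⊕ var 1F ⊕ var 2F ⊕ var 3F ⊕ ⊝ var 4F ⊕ ⊝ var 5F ⊕ ⊝ var 6F ⊕ ⊝ var 7F ⊕ 𝟘)
               ((var 0F ⊕ var 1F ⊕ var 2F ⊕ var 3F ⊕ 𝟘) ⊕
                ⊝ (var 4F ⊕ var 5F ⊕ var 6F ⊕ var 7F ⊕ 𝟘)) ≡.refl ⟩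
        sumΓ Γ 4 (f ∘ (Fin._↑ˡ 4)) ∙ sumΓ Γ 4 (f ∘ (4 Fin.↑ʳ_)) ⁻¹
          ≈⟨ ∙-cong (e-total 4 (g ∘ (Fin._↑ˡ 4))) (⁻¹-cong (e-total 4 (g ∘ (4 Fin.↑ʳ_)))) ⟨
        e (total _+₁₆_ 0F 4 (g ∘ (Fin._↑ˡ 4))) ∙ e (total _+₁₆_ 0F 4 (g ∘ (4 Fin.↑ʳ_))) ⁻¹
          ≡⟨ ≡.cong (λ i → e i ∙ e (total _+₁₆_ 0F 4 (g ∘ (4 Fin.↑ʳ_))) ⁻¹)
               (proj₁ (proj₂ (proj₂ W-isBase)) t) ⟩
        e (total _+₁₆_ 0F 4 (g ∘ (4 Fin.↑ʳ_))) ∙ e (total _+₁₆_ 0F 4 (g ∘ (4 Fin.↑ʳ_))) ⁻¹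
          ≈⟨ inverseʳ _ ⟩
        ε ∎
        where
        g : Fin 8 → Fin 16
        g = (λ x → W t x 0F) ∘ remQuot {4} 2
        f : Fin 8 → Carrier
        f = e ∘ g

      cover : ∀ κ h → ∃ λ t → ∃ λ x → e (W t x κ) ≈ embed P h
      cover κ h with e-onto h
      ... | i , eq with proj₂ (proj₂ (proj₂ W-isBase)) κ i
      ...   | t , b , s , W≡i = t , (b , s) , trans (reflexive (≡.cong e W≡i)) eq

    columns : Columns P 2
    columns = record
      { value      = λ t x κ → e (W t x κ)
      ; column-sum = λ { t (b , s) → column t b s }
      ; row-sum    = row
      ; signed-sum = paired
      ; covers     = cover
      }

  -- The chain of subgroups inside Γ

  index-unique : ∀ H k → k * size H ≡ N → index (indexed H) ≡ k
  index-unique H k eq = ℕ.*-cancelʳ-≡ _ _ (size H) ⦃ ℕ.>-nonZero (size-positive H) ⦄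
    (≡.trans (index*size (indexed H)) (≡.sym eq))

  adjoin : ∀ H g (u : Fin (size H)) → embed H u ≈ 2 · g → g ∉ H → Subgroup
  adjoin H g u eq g∉H = Extension.extension H g 1 u eq (minimal-prime H prime[2] (u , eq) g∉H)

  -- The index of H is the even number `k * 2`, so Cauchy's theorem supplies an element of order 2
  -- modulo H.
  square-root : ∀ H k → k * 2 * size H ≡ N → ∃ λ g → g ∉ H × 2 · g ∈ H
  square-root H k eq = cauchy (indexed H) prime[2] (divides k (index-unique H (k * 2) eq))

  -- Two distinct involutions x and y start the chain ⟨x⟩ ⊂ ⟨x,y⟩ ⊂ ⟨x,y,z⟩ ⊂ P, which doubles at
  -- each step. Only the last two steps can have a nonzero carry, namely 2z and 2w, of indices `u`
  -- and `v`.
  sixteen : ∀ m → m * 16 ≡ N → MoreThanOneInvolution Γ → Σ Subgroup λ P → size P ≡ 16 × Columns P 2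
  sixteen m m*16≡N (x , y , (x≉ε , xx≈ε) , (y≉ε , yy≈ε) , x≉y) =
    continue (square-root ⟨x,y⟩ (m * 2) (≡.trans (four m) m*16≡N))
    where
    four : ∀ m → m * 2 * 2 * 4 ≡ m * 16
    four = solve-∀
    eight : ∀ m → m * 2 * 8 ≡ m * 16
    eight = solve-∀
    double : ∀ {g} → g ∙ g ≈ ε → ε ≈ 2 · g
    double gg≈ε = sym (trans (∙-congˡ (identityʳ _)) gg≈ε)
    ⟨x⟩ : Subgroup
    ⟨x⟩ = adjoin trivial x 0F (double xx≈ε) λ { (_ , ε≈x) → x≉ε (sym ε≈x) }
    y∉⟨x⟩ : y ∉ ⟨x⟩
    y∉⟨x⟩ (0F , eq) = y≉ε (trans (sym eq) (identityˡ ε))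
    y∉⟨x⟩ (1F , eq) = x≉y (trans (sym (trans (identityʳ _) (identityʳ x))) eq)
    ⟨x,y⟩ : Subgroup
    ⟨x,y⟩ = adjoin ⟨x⟩ y 0F (trans (identityˡ ε) (double yy≈ε)) y∉⟨x⟩
    continue : (∃ λ z → z ∉ ⟨x,y⟩ × 2 · z ∈ ⟨x,y⟩) → Σ Subgroup λ P → size P ≡ 16 × Columns P 2
    continue (z , z∉ , u , u≈2z) = finish (square-root ⟨x,y,z⟩ m (≡.trans (eight m) m*16≡N))
      where
      ⟨x,y,z⟩ : Subgroup
      ⟨x,y,z⟩ = adjoin ⟨x,y⟩ z u u≈2z z∉
      finish : (∃ λ w → w ∉ ⟨x,y,z⟩ × 2 · w ∈ ⟨x,y,z⟩) → Σ Subgroup λ P → size P ≡ 16 × Columns P 2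
      -- The addition of P computes to `law u v`, so the table for these two carries applies as it
      -- stands.
      finish (w , w∉ , v , v≈2w) = P , ≡.refl ,
        Base.columns P (embed P) (embed-unit P) (law u v) (embed-add P) (base u v) (base-isBase u v) (λ h → h , refl)
        where
        P : Subgroup
        P = adjoin ⟨x,y,z⟩ w v v≈2w w∉

  full : Subgroup
  full = record
    { size = N ; embed = element ; embed-injective = element-injective
    ; unit = indexOf ε ; embed-unit = element-indexOf ε
    ; add = λ i j → indexOf (element i ∙ element j) ; embed-add = λ i j → element-indexOf _ }

  -- g is the difference of (2q + 1)·g and q·(2·g), both of which lie in H.
  halve : ∀ H q → (∀ g → suc (q * 2) · g ∈ H) → ∀ {g} → g ∙ g ∈ H → g ∈ H
  halve H q annihilated {g} gg∈H = ∈-resp H (begin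
    suc (q * 2) · g ∙ (q · (2 · g)) ⁻¹     ≈⟨ ∙-congˡ (⁻¹-cong (×-assocˡ g q 2)) ⟩
    suc (q * 2) · g ∙ ((q * 2) · g) ⁻¹     ≈⟨ solve (g ∷ (q * 2) · g ∷ []) ((var 0F ⊕ var 1F) ⊕ ⊝ var 1F) (var 0F) ≡.refl ⟩
    g                                      ∎)
    (∈-∙ H (annihilated g) (∈-⁻¹ H (∈-· H q (∈-resp H (∙-congˡ (sym (identityʳ g))) gg∈H))))

  odd-index-annihilates : ∀ H q → suc (q * 2) * size H ≡ N → ∀ g → suc (q * 2) · g ∈ H
  odd-index-annihilates H q eq g =
    ∈-resp H (×-congˡ (index-unique H (suc (q * 2)) eq)) (annihilates (indexed H) g)

  -- A relative converse of Lagrange's theorem: n is split into primes, which `grow` adjoins one at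
  -- a time.
  enlarge : ∀ n k H .⦃ _ : ℕ.NonZero n ⦄ → n * k * size H ≡ N → ∃ λ K → H ⊆ K × size K ≡ n * size H
  enlarge n k H eq with grow (PrimeFactorisation.factorsPrime (factorise n)) H
    (divides k (≡.trans (index-unique H (n * k) eq) (≡.trans (ℕ.*-comm n k) (≡.cong (k *_) isFactorisation))))
    where open PrimeFactorisation (factorise n) using (isFactorisation)
  ... | K , H⊆K , size≡ = K , H⊆K ,
        ≡.trans size≡ (≡.cong (_* size H) (≡.sym (PrimeFactorisation.isFactorisation (factorise n))))

  -- Here `l` is one less than in the theorem, so that a first pair ±x₀ of representatives is always
  -- available for the top three rows; l further pairs fill the rows below.
  construction : ∀ l h → N ≡ 16 * (2 * suc l + 1) * (2 * h + 1) → MoreThanOneInvolution Γ →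
                 MRS Γ (3 + l * 2) 8 (2 + h * 4)
  construction l h N≡ involutions = with-P (sixteen (suc (suc l * 2) * suc (h * 2)) (≡.trans (order₁ l h) (≡.sym N≡)) involutions)
    where
    order₁ : ∀ l h → suc (suc l * 2) * suc (h * 2) * 16 ≡ 16 * (2 * suc l + 1) * (2 * h + 1)
    order₁ = solve-∀
    order₂ : ∀ l h → suc (h * 2) * suc (suc l * 2) * 16 ≡ 16 * (2 * suc l + 1) * (2 * h + 1)
    order₂ = solve-∀
    order₃ : ∀ l h → suc (suc l * 2) * (suc (h * 2) * 16) ≡ 16 * (2 * suc l + 1) * (2 * h + 1)
    order₃ = solve-∀
    order₄ : ∀ l h → (2 + h * 4) * ((3 + l * 2) * 8) ≡ 16 * (2 * suc l + 1) * (2 * h + 1)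
    order₄ = solve-∀
    order₅ : ∀ l h → suc ((suc l + h + 2 * suc l * h) * 2) * 16 ≡ 16 * (2 * suc l + 1) * (2 * h + 1)
    order₅ = solve-∀
    with-P : (Σ Subgroup λ P → size P ≡ 16 × Columns P 2) → MRS Γ (3 + l * 2) 8 (2 + h * 4)
    with-P (P , size-P , V) = with-K (enlarge (suc (h * 2)) (suc (suc l * 2)) P
                                (≡.trans (≡.cong (suc (h * 2) * suc (suc l * 2) *_) size-P) (≡.trans (order₂ l h) (≡.sym N≡))))
      where
      -- 2q + 1 = (2l + 3)(2h + 1) is the index of P in Γ.
      q = suc l + h + 2 * suc l * h
      annihilated-P : ∀ g → suc (q * 2) · g ∈ P
      annihilated-P = odd-index-annihilates P q
        (≡.trans (≡.cong (suc (q * 2) *_) size-P) (≡.trans (order₅ l h) (≡.sym N≡)))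
      with-K : (∃ λ K → P ⊆ K × size K ≡ suc (h * 2) * size P) → MRS Γ (3 + l * 2) 8 (2 + h * 4)
      -- `K`, of order 16(2h + 1), is the subgroup called H in the opening overview.
      with-K (K , P⊆K , size-K) =
        Assemble.magic-rectangles {K} {2 + h * 4} {l} (Lift.columns V (proj₁ Y) (proj₂ Y) q annihilated-P)
          (proj₁ X) (λ g → proj₂ X (indexOf g , element-indexOf g)) (≡.trans (order₄ l h) (≡.sym N≡))
        where
        index-K : suc (suc l * 2) * size K ≡ N
        index-K = ≡.trans (≡.cong (suc (suc l * 2) *_) (≡.trans size-K (≡.cong (suc (h * 2) *_) size-P)))
                          (≡.trans (order₃ l h) (≡.sym N≡))
        Y : Σ (Vec Carrier h) λ Y → ∀ {g} → g ∈ K → Coset P Y g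
        Y = Transversal.symmetric-transversal P K P⊆K (halve P q annihilated-P) size-K
        X : Σ (Vec Carrier (suc l)) λ X → ∀ {g} → g ∈ full → Coset K X g
        X = Transversal.symmetric-transversal K full (λ {g} _ → indexOf g , element-indexOf g)
          (halve K (suc l) (odd-index-annihilates K (suc l) index-K)) (≡.sym index-K)

theorem1p8 : {c ℓ : Level} (l h : ℕ) → l ≥ 1 → (Γ : AbelianGroup c ℓ) →
    HasOrder Γ (16 * (2 * l + 1) * (2 * h + 1)) →
    (MRS Γ (2 * l + 1) 8 (4 * h + 2) ⇔ MoreThanOneInvolution Γ)
theorem1p8 (suc l) h (s≤s _) Γ order = mk⇔
  (λ M → Necessity.MRS⇒involutions Γ order M (divides (8 * (2 * suc l + 1) * (2 * h + 1)) (even l h)) {suc l} ≡.refl (cells l h))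
  (λ involutions → ≡.subst₂ (λ a c′ → MRS Γ a 8 c′) (rows l) (arrays h)
    (Sufficiency.construction Γ order l h ≡.refl involutions))
  where
  even : ∀ l h → 16 * (2 * suc l + 1) * (2 * h + 1) ≡ 8 * (2 * suc l + 1) * (2 * h + 1) * 2
  even = solve-∀
  cells : ∀ l h → 16 * (2 * suc l + 1) * (2 * h + 1) ≡ (2 * suc l + 1) * ((4 * h + 2) * 8)
  cells = solve-∀
  rows : ∀ l → 3 + l * 2 ≡ 2 * suc l + 1
  rows = solve-∀
  arrays : ∀ h → 2 + h * 4 ≡ 4 * h + 2
  arrays = solve-∀
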